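{- Every perfect code $Z\subset\{0,1\}^n$ is discrepancy-minimizing, i.e. $D^{L_2}(Z)\le D^{L_2}(Z')$ for every $Z'\subset\{0,1\}^n$ with $|Z'|=|Z|$.
   Context: $d$ is the Hamming distance, $B(x,t)=\{y:d(x,y)\le t\}$. A code $Z\subset\{0,1\}^n$ is perfect if there is an integer $e\ge0$ such that every $x\in\{0,1\}^n$ is at distance at most $e$ from exactly one element of $Z$. For $Z=\{z_1,\dots,z_N\}$, $D^{L_2}(Z)=\sum_{t=0}^n\sum_{x\in\{0,1\}^n}\Big(\frac1N\sum_{j=1}^N\mathbb 1_{B(x,t)}(z_j)-\frac{|B(x,t)|}{2^n}\Big)^2$. -}

module Defs where

open import Data.Bool using (Bool; true; false; if_then_else_)
open import Data.Nat as ℕ using (ℕ; zero; suc; _≤?_; _^_)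
open import Data.Integer using (+_)
open import Data.Rational using (ℚ; 0ℚ; _+_; _-_; _*_; _/_)
open import Data.Vec using (Vec; []; _∷_)
open import Data.List using (List; []; _∷_; map; concatMap; foldr; filter; length; upTo)
open import Data.Bool.Properties using () renaming (_≟_ to _≟B_)
open import Relation.Nullary.Decidable using (does)

allWords : (n : ℕ) → List (Vec Bool n)
allWords zero = [] ∷ []
allWords (suc n) = concatMap (λ w → (false ∷ w) ∷ (true ∷ w) ∷ []) (allWords n)

hamming : ∀ {n} → Vec Bool n → Vec Bool n → ℕ
hamming [] [] = 0
hamming (a ∷ x) (b ∷ y) = (if does (a ≟B b) then 0 else 1) ℕ.+ hamming x y

countIn : ∀ {n} → Vec Bool n → ℕ → List (Vec Bool n) → ℕ
countIn x t Z = length (filter (λ z → hamming x z ≤? t) Z)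

ballSize : ∀ {n} → Vec Bool n → ℕ → ℕ
ballSize {n} x t = countIn x t (allWords n)

-- c / N as a rational (the case N = 0 is never used for nonempty codes)
frac : ℕ → ℕ → ℚ
frac c zero = 0ℚ
frac c (suc m) = (+ c) / suc m

sumℚ : List ℚ → ℚ
sumℚ = foldr _+_ 0ℚ

-- A code is a duplicate-free list of words (see Statement: Unique)
-- D^{L_2}(Z) = Σ_{t=0}^n Σ_x ( (1/N) Σ_j 1_{B(x,t)}(z_j) - |B(x,t)|/2^n )^2
discrepancyL2 : ∀ {n} → List (Vec Bool n) → ℚ
discrepancyL2 {n} Z =
  sumℚ (map (λ t → sumℚ (map (λ x →
    let d = frac (countIn x t Z) (length Z) - frac (ballSize x t) (2 ^ n)
    in d * d) (allWords n))) (upTo (suc n)))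

IsPerfect : ∀ {n} → List (Vec Bool n) → Set
IsPerfect {n} Z = Σ ℕ λ e → ∀ (x : Vec Bool n) → countIn x e Z ≡ 1
  where open import Data.Product using (Σ)
        open import Relation.Binary.PropositionalEquality using (_≡_)

{-# OPTIONS --safe #-}
module Submission where

-- Put h = 2ⁿ·1_Z − N and let X(u) = n + 1 − 2|u|. By Parseval the scaled discrepancy is
-- Σ_u c(u) ĥ(u)² with c = Σ_t g_t², where g_t(u) is the eigenvalue of the ball of radius t
-- at the character u.
-- (1) Every even moment Σ_u X(u)²ʳ ĥ(u)² is minimised by a perfect code of radius e: since
--     X g_t = (t+1) g_{t+1} + (n−t) g_{t−1}, the power X²ʳ is a nonnegative combination of
--     g_i, g_e g_i (i < e) and of even powers of X times g_e². For the first two kinds the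
--     sum is, up to constants, Σ_x |Z ∩ B(x,i)| |Z ∩ B(x,j)|, which is smallest when the
--     counts are 0 or 1; the last kind is nonnegative and vanishes on a perfect code.
-- (2) For u ≠ 0 the recurrence also gives c ∝ (2i−1)!! (2j−1)!! with i = n − |u| and
--     j = |u| − 1, which is a limit of constant multiples of Π_{l<L} 1/((n+2l)² − X²).
--     Expanding the geometric series, this is a nonnegative series in X².

open import Defs
open import Data.Bool using (Bool)
open import Data.Nat using (ℕ)
open import Data.Vec using (Vec)
open import Data.List using (List; length)
open import Data.List.Relation.Unary.Unique.Propositional using (Unique)
open import Relation.Binary.PropositionalEquality using (_≡_)

-- The recurrence is a count: a word at distance d from the centre of a ball of radius t has all n +
-- 1 words of its unit ball inside when d < t, t + 1 of them when d is t or t + 1, and none beyond.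
-- Only even moments are within reach. Each use of the recurrence spends one X and moves an index by
-- one, so a term X^l g_e² inherits in l the parity of the original power, and an odd power of X has
-- no sign. The limit in (2) has a normalisation independent of u because i + j = n - 1 for every u
-- ≠ 0: the product of the l factors times the weight equals `γ (l + i) * γ (l + j)`, which lies
-- between (2l)^(n-1) and (2l + 2(n-1))^(n-1) times `γ l` squared. Neither series nor limit is
-- formed. Division by A - X², with A = (n + 2l)², is an argument by contradiction comparing two
-- geometric growth rates, and the limit is an inequality for each l closed by Bernoulli.
-- Reciprocals become cofactors of a common multiple, so that everything before the last part takes
-- place in ℤ and ℕ.

-- Sums over the cube, the Walsh transform, and ball counts as convolutions

module WalshTransform where

  open import Data.Bool using (Bool; true; false; not; if_then_else_)
  open import Data.Nat as ℕ using (ℕ; zero; suc; _≤?_)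
  open import Data.Integer using (ℤ; +_; 0ℤ; 1ℤ; _+_; _*_; _-_; -_; _≤_)
  import Data.Integer.Properties as ℤ
  open import Data.Integer.Tactic.RingSolver using (solve-∀)
  open import Data.Vec using (Vec; []; _∷_; replicate)
  open import Data.List using (List; []; _∷_; length)
  open import Relation.Binary.PropositionalEquality
  open import Relation.Nullary.Decidable using (does)
  open import Algebra.Properties.CommutativeSemigroup ℤ.+-commutativeSemigroup using (interchange)
  open ≡-Reasoning

  Word : ℕ → Set
  Word = Vec Bool

  -- The first coordinate is summed innermost, which matches the recursion of `hat` and of
  -- `allWords`.
  ∑ : ∀ {n} → (Word n → ℤ) → ℤ
  ∑ {zero}  f = f []
  ∑ {suc n} f = ∑ λ w → f (false ∷ w) + f (true ∷ w)

  ∑-cong : ∀ {n} {f g : Word n → ℤ} → (∀ x → f x ≡ g x) → ∑ f ≡ ∑ g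
  ∑-cong {zero}  p = p []
  ∑-cong {suc n} p = ∑-cong λ w → cong₂ _+_ (p (false ∷ w)) (p (true ∷ w))

  ∑-mono : ∀ {n} {f g : Word n → ℤ} → (∀ x → f x ≤ g x) → ∑ f ≤ ∑ g
  ∑-mono {zero}  p = p []
  ∑-mono {suc n} p = ∑-mono λ w → ℤ.+-mono-≤ (p (false ∷ w)) (p (true ∷ w))

  ∑-+ : ∀ {n} (f g : Word n → ℤ) → ∑ (λ x → f x + g x) ≡ ∑ f + ∑ g
  ∑-+ {zero}  f g = refl
  ∑-+ {suc n} f g = trans
    (∑-cong λ w → interchange (f (false ∷ w)) (g (false ∷ w)) (f (true ∷ w)) (g (true ∷ w)))
    (∑-+ (λ w → f (false ∷ w) + f (true ∷ w)) (λ w → g (false ∷ w) + g (true ∷ w)))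

  ∑-* : ∀ {n} c (f : Word n → ℤ) → ∑ (λ x → c * f x) ≡ c * ∑ f
  ∑-* {zero}  c f = refl
  ∑-* {suc n} c f = trans
    (∑-cong λ w → sym (ℤ.*-distribˡ-+ c (f (false ∷ w)) (f (true ∷ w))))
    (∑-* c (λ w → f (false ∷ w) + f (true ∷ w)))

  ∑-const : ∀ n c → ∑ {n} (λ _ → c) ≡ + (2 ℕ.^ n) * c
  ∑-const zero    c = sym (ℤ.*-identityˡ c)
  ∑-const (suc n) c = begin
    ∑ {n} (λ _ → c + c)          ≡⟨ ∑-const n (c + c) ⟩
    + (2 ℕ.^ n) * (c + c)        ≡⟨ double (+ (2 ℕ.^ n)) c ⟩
    + 2 * + (2 ℕ.^ n) * c        ≡⟨ cong (_* c) (sym (ℤ.pos-* 2 (2 ℕ.^ n))) ⟩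
    + (2 ℕ.^ suc n) * c          ∎
    where
    double : ∀ p c → p * (c + c) ≡ + 2 * p * c
    double = solve-∀

  -- The unnormalised Walsh-Hadamard transform, the sum over x of (-1)^(u·x) f(x), computed by the
  -- butterfly one coordinate at a time.
  hat : ∀ {n} → (Word n → ℤ) → Word n → ℤ
  hat f []          = f []
  hat f (false ∷ u) = hat (λ w → f (false ∷ w) + f (true ∷ w)) u
  hat f (true  ∷ u) = hat (λ w → f (false ∷ w) - f (true ∷ w)) u

  hat-cong : ∀ {n} {f g : Word n → ℤ} → (∀ x → f x ≡ g x) → ∀ u → hat f u ≡ hat g u
  hat-cong p []          = p []
  hat-cong p (false ∷ u) = hat-cong (λ w → cong₂ _+_ (p (false ∷ w)) (p (true ∷ w))) u
  hat-cong p (true  ∷ u) = hat-cong (λ w → cong₂ _-_ (p (false ∷ w)) (p (true ∷ w))) u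

  hat-+ : ∀ {n} (f g : Word n → ℤ) u → hat (λ x → f x + g x) u ≡ hat f u + hat g u
  hat-+ f g []          = refl
  hat-+ f g (false ∷ u) = trans
    (hat-cong (λ w → interchange (f (false ∷ w)) (g (false ∷ w)) (f (true ∷ w)) (g (true ∷ w))) u)
    (hat-+ _ _ u)
  hat-+ f g (true ∷ u) = trans
    (hat-cong (λ w → lemma (f (false ∷ w)) (g (false ∷ w)) (f (true ∷ w)) (g (true ∷ w))) u)
    (hat-+ _ _ u)
    where
    lemma : ∀ a b c d → (a + b) - (c + d) ≡ (a - c) + (b - d)
    lemma = solve-∀

  hat-neg : ∀ {n} (f : Word n → ℤ) u → hat (λ x → - f x) u ≡ - hat f u
  hat-neg f []          = refl
  hat-neg f (false ∷ u) = trans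
    (hat-cong (λ w → sym (ℤ.neg-distrib-+ (f (false ∷ w)) (f (true ∷ w)))) u) (hat-neg _ u)
  hat-neg f (true ∷ u) = trans
    (hat-cong (λ w → sym (ℤ.neg-distrib-+ (f (false ∷ w)) (- f (true ∷ w)))) u) (hat-neg _ u)

  hat-sub : ∀ {n} (f g : Word n → ℤ) u → hat (λ x → f x - g x) u ≡ hat f u - hat g u
  hat-sub f g u = trans (hat-+ f (λ x → - g x) u) (cong (_+_ (hat f u)) (hat-neg g u))

  parseval : ∀ {n} (f g : Word n → ℤ) →
    ∑ (λ u → hat f u * hat g u) ≡ + (2 ℕ.^ n) * ∑ (λ x → f x * g x)
  parseval {zero}  f g = sym (ℤ.*-identityˡ _)
  parseval {suc n} f g = begin
    ∑ (λ u → hat f⁺ u * hat g⁺ u + hat f⁻ u * hat g⁻ u)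
      ≡⟨ ∑-+ (λ u → hat f⁺ u * hat g⁺ u) (λ u → hat f⁻ u * hat g⁻ u) ⟩
    ∑ (λ u → hat f⁺ u * hat g⁺ u) + ∑ (λ u → hat f⁻ u * hat g⁻ u)
      ≡⟨ cong₂ _+_ (parseval f⁺ g⁺) (parseval f⁻ g⁻) ⟩
    p * ∑ (λ x → f⁺ x * g⁺ x) + p * ∑ (λ x → f⁻ x * g⁻ x)
      ≡⟨ sym (ℤ.*-distribˡ-+ p _ _) ⟩
    p * (∑ (λ x → f⁺ x * g⁺ x) + ∑ (λ x → f⁻ x * g⁻ x))
      ≡⟨ cong (p *_) (sym (∑-+ (λ x → f⁺ x * g⁺ x) (λ x → f⁻ x * g⁻ x))) ⟩
    p * ∑ (λ x → f⁺ x * g⁺ x + f⁻ x * g⁻ x)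
      ≡⟨ cong (p *_) (∑-cong λ x → polarise (f (false ∷ x)) (f (true ∷ x)) (g (false ∷ x)) (g (true ∷ x))) ⟩
    p * ∑ (λ x → + 2 * fg x)
      ≡⟨ cong (p *_) (∑-* (+ 2) fg) ⟩
    p * (+ 2 * ∑ fg)
      ≡⟨ shuffle p (∑ fg) ⟩
    + 2 * p * ∑ fg
      ≡⟨ cong (_* ∑ fg) (sym (ℤ.pos-* 2 (2 ℕ.^ n))) ⟩
    + (2 ℕ.^ suc n) * ∑ fg ∎
    where
    p = + (2 ℕ.^ n)
    f⁺ f⁻ g⁺ g⁻ fg : Word n → ℤ
    f⁺ w = f (false ∷ w) + f (true ∷ w)
    f⁻ w = f (false ∷ w) - f (true ∷ w)
    g⁺ w = g (false ∷ w) + g (true ∷ w)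
    g⁻ w = g (false ∷ w) - g (true ∷ w)
    fg w = f (false ∷ w) * g (false ∷ w) + f (true ∷ w) * g (true ∷ w)
    polarise : ∀ a b c d → (a + b) * (c + d) + (a - b) * (c - d) ≡ + 2 * (a * c + b * d)
    polarise = solve-∀
    shuffle : ∀ p q → p * (+ 2 * q) ≡ + 2 * p * q
    shuffle = solve-∀

  -- ball s sums f over the open ball { y : d(x,y) < s }, so radius t is s = t + 1.
  ball : ∀ {n} → ℕ → (Word n → ℤ) → Word n → ℤ
  ball zero    f x        = 0ℤ
  ball (suc s) f []       = f []
  ball (suc s) f (b ∷ x)  = ball (suc s) (λ w → f (b ∷ w)) x + ball s (λ w → f (not b ∷ w)) x

  -- G s u is the eigenvalue of ball s at the character u; as a function of the weight of u
  -- it is the Krawtchouk polynomial of degree s - 1 and length n - 1, shifted by one.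
  G : ∀ {n} → ℕ → Word n → ℤ
  G zero    u           = 0ℤ
  G (suc s) []          = 1ℤ
  G (suc s) (false ∷ u) = G (suc s) u + G s u
  G (suc s) (true  ∷ u) = G (suc s) u - G s u

  hat-0 : ∀ {n} (u : Word n) → hat (λ _ → 0ℤ) u ≡ 0ℤ
  hat-0 []          = refl
  hat-0 (false ∷ u) = hat-0 u
  hat-0 (true  ∷ u) = hat-0 u

  -- Summing over balls is a convolution, hence diagonal in the characters. The induction splits a
  -- ball by the first coordinate: the tail keeps the radius if that bit agrees and loses one if it
  -- differs.
  hat-ball : ∀ {n} s (f : Word n → ℤ) u → hat (ball s f) u ≡ G s u * hat f u
  hat-ball zero    f u  = hat-0 u
  hat-ball (suc s) f [] = sym (ℤ.*-identityˡ (f []))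
  hat-ball {suc n} (suc s) f (false ∷ u) = begin
    hat (λ w → (ball (suc s) f₀ w + ball s f₁ w) + (ball (suc s) f₁ w + ball s f₀ w)) u
      ≡⟨ hat-+ (λ w → ball (suc s) f₀ w + ball s f₁ w) (λ w → ball (suc s) f₁ w + ball s f₀ w) u ⟩
    hat (λ w → ball (suc s) f₀ w + ball s f₁ w) u + hat (λ w → ball (suc s) f₁ w + ball s f₀ w) u
      ≡⟨ cong₂ _+_ (hat-+ (ball (suc s) f₀) (ball s f₁) u) (hat-+ (ball (suc s) f₁) (ball s f₀) u) ⟩
    (hat (ball (suc s) f₀) u + hat (ball s f₁) u) + (hat (ball (suc s) f₁) u + hat (ball s f₀) u)
      ≡⟨ cong₂ _+_ (cong₂ _+_ (hat-ball (suc s) f₀ u) (hat-ball s f₁ u))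
                   (cong₂ _+_ (hat-ball (suc s) f₁ u) (hat-ball s f₀ u)) ⟩
    (G (suc s) u * hat f₀ u + G s u * hat f₁ u) + (G (suc s) u * hat f₁ u + G s u * hat f₀ u)
      ≡⟨ collect (G (suc s) u) (G s u) (hat f₀ u) (hat f₁ u) ⟩
    (G (suc s) u + G s u) * (hat f₀ u + hat f₁ u)
      ≡⟨ cong ((G (suc s) u + G s u) *_) (sym (hat-+ f₀ f₁ u)) ⟩
    (G (suc s) u + G s u) * hat (λ w → f₀ w + f₁ w) u ∎
    where
    f₀ f₁ : Word n → ℤ
    f₀ w = f (false ∷ w)
    f₁ w = f (true ∷ w)
    collect : ∀ p q a b → (p * a + q * b) + (p * b + q * a) ≡ (p + q) * (a + b)
    collect = solve-∀
  hat-ball {suc n} (suc s) f (true ∷ u) = begin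
    hat (λ w → (ball (suc s) f₀ w + ball s f₁ w) - (ball (suc s) f₁ w + ball s f₀ w)) u
      ≡⟨ hat-sub (λ w → ball (suc s) f₀ w + ball s f₁ w) (λ w → ball (suc s) f₁ w + ball s f₀ w) u ⟩
    hat (λ w → ball (suc s) f₀ w + ball s f₁ w) u - hat (λ w → ball (suc s) f₁ w + ball s f₀ w) u
      ≡⟨ cong₂ _-_ (hat-+ (ball (suc s) f₀) (ball s f₁) u) (hat-+ (ball (suc s) f₁) (ball s f₀) u) ⟩
    (hat (ball (suc s) f₀) u + hat (ball s f₁) u) - (hat (ball (suc s) f₁) u + hat (ball s f₀) u)
      ≡⟨ cong₂ _-_ (cong₂ _+_ (hat-ball (suc s) f₀ u) (hat-ball s f₁ u))
                   (cong₂ _+_ (hat-ball (suc s) f₁ u) (hat-ball s f₀ u)) ⟩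
    (G (suc s) u * hat f₀ u + G s u * hat f₁ u) - (G (suc s) u * hat f₁ u + G s u * hat f₀ u)
      ≡⟨ collect (G (suc s) u) (G s u) (hat f₀ u) (hat f₁ u) ⟩
    (G (suc s) u - G s u) * (hat f₀ u - hat f₁ u)
      ≡⟨ cong ((G (suc s) u - G s u) *_) (sym (hat-sub f₀ f₁ u)) ⟩
    (G (suc s) u - G s u) * hat (λ w → f₀ w - f₁ w) u ∎
    where
    f₀ f₁ : Word n → ℤ
    f₀ w = f (false ∷ w)
    f₁ w = f (true ∷ w)
    collect : ∀ p q a b → (p * a + q * b) - (p * b + q * a) ≡ (p - q) * (a - b)
    collect = solve-∀

  𝟎 : ∀ {n} → Word n
  𝟎 = replicate _ false

  hat-𝟎 : ∀ {n} (f : Word n → ℤ) → hat f 𝟎 ≡ ∑ f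
  hat-𝟎 {zero}  f = refl
  hat-𝟎 {suc n} f = hat-𝟎 (λ w → f (false ∷ w) + f (true ∷ w))

  -- Double counting, read off at the trivial character, where the eigenvalue is the size of the
  -- ball.
  ∑-ball : ∀ {n} s (f : Word n → ℤ) → ∑ (ball s f) ≡ G s (𝟎 {n}) * ∑ f
  ∑-ball {n} s f = begin
    ∑ (ball s f)          ≡⟨ sym (hat-𝟎 (ball s f)) ⟩
    hat (ball s f) 𝟎      ≡⟨ hat-ball s f 𝟎 ⟩
    G s (𝟎 {n}) * hat f 𝟎 ≡⟨ cong (G s (𝟎 {n}) *_) (hat-𝟎 f) ⟩
    G s (𝟎 {n}) * ∑ f     ∎

  ball-affine : ∀ {n} s c d (f : Word n → ℤ) x →
    ball s (λ w → c * f w + d) x ≡ c * ball s f x + d * G s (𝟎 {n})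
  ball-affine zero c d f x = lemma c d
    where
    lemma : ∀ c d → 0ℤ ≡ c * 0ℤ + d * 0ℤ
    lemma = solve-∀
  ball-affine (suc s) c d f [] = cong (_+_ (c * f [])) (sym (ℤ.*-identityʳ d))
  ball-affine {suc n} (suc s) c d f (b ∷ x) = trans
    (cong₂ _+_ (ball-affine (suc s) c d (λ w → f (b ∷ w)) x) (ball-affine s c d (λ w → f (not b ∷ w)) x))
    (lemma c d (ball (suc s) (λ w → f (b ∷ w)) x) (ball s (λ w → f (not b ∷ w)) x) (G (suc s) (𝟎 {n})) (G s (𝟎 {n})))
    where
    lemma : ∀ c d p q r t → (c * p + d * r) + (c * q + d * t) ≡ c * (p + q) + d * (r + t)
    lemma = solve-∀

  ball-+ : ∀ {n} s (f g : Word n → ℤ) x → ball s (λ w → f w + g w) x ≡ ball s f x + ball s g x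
  ball-+ zero    f g x       = refl
  ball-+ (suc s) f g []      = refl
  ball-+ (suc s) f g (b ∷ x) = trans
    (cong₂ _+_ (ball-+ (suc s) (λ w → f (b ∷ w)) (λ w → g (b ∷ w)) x)
               (ball-+ s (λ w → f (not b ∷ w)) (λ w → g (not b ∷ w)) x))
    (interchange (ball (suc s) (λ w → f (b ∷ w)) x) _ (ball s (λ w → f (not b ∷ w)) x) _)

  ball-0 : ∀ {n} s (x : Word n) → ball s (λ _ → 0ℤ) x ≡ 0ℤ
  ball-0 zero    x       = refl
  ball-0 (suc s) []      = refl
  ball-0 (suc s) (b ∷ x) = cong₂ _+_ (ball-0 (suc s) x) (ball-0 s x)

  ball-cong : ∀ {n} s {f g : Word n → ℤ} → (∀ x → f x ≡ g x) → ∀ x → ball s f x ≡ ball s g x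
  ball-cong zero    p x       = refl
  ball-cong (suc s) p []      = p []
  ball-cong (suc s) p (b ∷ x) = cong₂ _+_ (ball-cong (suc s) (λ w → p (b ∷ w)) x)
                                          (ball-cong s (λ w → p (not b ∷ w)) x)

  within : ∀ {n} → ℕ → Word n → Word n → ℕ
  within t x z = if does (hamming x z ≤? t) then 1 else 0

  countIn-∷ : ∀ {n} (x : Word n) t z Z → countIn x t (z ∷ Z) ≡ within t x z ℕ.+ countIn x t Z
  countIn-∷ x t z Z with does (hamming x z ≤? t)
  ... | true  = refl
  ... | false = refl

  -- The decision `suc k ≤? suc t` computes to the left boolean and `k ≤? t` to the right one.
  <ᵇ-suc : ∀ k t → (k ℕ.<ᵇ suc t) ≡ (k ℕ.≤ᵇ t)
  <ᵇ-suc zero    t = refl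
  <ᵇ-suc (suc k) t = refl

  -- A differing bit lowers the radius, possibly to the empty ball; the companion `ball-within-pred`
  -- covers that case by comparing the successor of the distance.
  ball-within : ∀ {n} t (z x : Word n) → ball (suc t) (λ w → + within 0 w z) x ≡ + within t x z
  ball-within-pred : ∀ {n} t (z x : Word n) →
    ball t (λ w → + within 0 w z) x ≡ + (if does (suc (hamming x z) ≤? t) then 1 else 0)

  ball-within t [] [] = refl
  ball-within t (false ∷ z) (false ∷ x) =
    trans (cong₂ _+_ (ball-within t z x) (ball-0 t x)) (ℤ.+-identityʳ _)
  ball-within t (true ∷ z) (true ∷ x) =
    trans (cong₂ _+_ (ball-within t z x) (ball-0 t x)) (ℤ.+-identityʳ _)
  ball-within t (true ∷ z) (false ∷ x) =
    trans (cong₂ _+_ (ball-0 (suc t) x) (ball-within-pred t z x)) (ℤ.+-identityˡ _)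
  ball-within t (false ∷ z) (true ∷ x) =
    trans (cong₂ _+_ (ball-0 (suc t) x) (ball-within-pred t z x)) (ℤ.+-identityˡ _)

  ball-within-pred zero    z x = refl
  ball-within-pred (suc t) z x = trans (ball-within t z x)
    (cong (λ b → + (if b then 1 else 0)) (sym (<ᵇ-suc (hamming x z) t)))

  -- The radius-0 count is the multiplicity of x in Z. It serves as the indicator function of the
  -- code and is additive in the list.
  mult : ∀ {n} → List (Word n) → Word n → ℤ
  mult Z x = + countIn x 0 Z

  ball-mult : ∀ {n} t (Z : List (Word n)) x → ball (suc t) (mult Z) x ≡ + countIn x t Z
  ball-mult t []      x = ball-0 (suc t) x
  ball-mult t (z ∷ Z) x = begin
    ball (suc t) (mult (z ∷ Z)) x
      ≡⟨ ball-cong (suc t) (λ w → cong +_ (countIn-∷ w 0 z Z)) x ⟩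
    ball (suc t) (λ w → + within 0 w z + mult Z w) x
      ≡⟨ ball-+ (suc t) (λ w → + within 0 w z) (mult Z) x ⟩
    ball (suc t) (λ w → + within 0 w z) x + ball (suc t) (mult Z) x
      ≡⟨ cong₂ _+_ (ball-within t z x) (ball-mult t Z x) ⟩
    + (within t x z ℕ.+ countIn x t Z)
      ≡⟨ cong +_ (sym (countIn-∷ x t z Z)) ⟩
    + countIn x t (z ∷ Z) ∎

  ∑-within-0 : ∀ {n} (z : Word n) → ∑ (λ x → + within 0 x z) ≡ 1ℤ
  ∑-within-0 [] = refl
  ∑-within-0 {suc n} (false ∷ z) =
    trans (∑-cong {n} λ x → ℤ.+-identityʳ (+ within 0 x z)) (∑-within-0 z)
  ∑-within-0 {suc n} (true ∷ z) =
    trans (∑-cong {n} λ x → ℤ.+-identityˡ (+ within 0 x z)) (∑-within-0 z)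

  ∑-mult : ∀ {n} (Z : List (Word n)) → ∑ (mult Z) ≡ + length Z
  ∑-mult {n} [] = trans (∑-const n 0ℤ) (ℤ.*-zeroʳ (+ (2 ℕ.^ n)))
  ∑-mult (z ∷ Z) = begin
    ∑ (mult (z ∷ Z))                       ≡⟨ ∑-cong (λ x → cong +_ (countIn-∷ x 0 z Z)) ⟩
    ∑ (λ x → + within 0 x z + mult Z x)    ≡⟨ ∑-+ (λ x → + within 0 x z) (mult Z) ⟩
    ∑ (λ x → + within 0 x z) + ∑ (mult Z)  ≡⟨ cong₂ _+_ (∑-within-0 z) (∑-mult Z) ⟩
    + length (z ∷ Z)                       ∎

  ∑-countIn : ∀ {n} t (Z : List (Word n)) → ∑ (λ x → + countIn x t Z) ≡ G (suc t) (𝟎 {n}) * + length Z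
  ∑-countIn {n} t Z = begin
    ∑ (λ x → + countIn x t Z)              ≡⟨ ∑-cong (λ x → sym (ball-mult t Z x)) ⟩
    ∑ (ball (suc t) (mult Z))              ≡⟨ ∑-ball (suc t) (mult Z) ⟩
    G (suc t) (𝟎 {n}) * ∑ (mult Z)         ≡⟨ cong (G (suc t) (𝟎 {n}) *_) (∑-mult Z) ⟩
    G (suc t) (𝟎 {n}) * + length Z         ∎

-- Eigenvalues of balls and the closed form for the sum of their squares

module BallSpectrum where

  open WalshTransform
  open import Data.Bool using (true; false)
  open import Data.Nat as ℕ using (ℕ; zero; suc; s≤s; z≤n; _!)
  import Data.Nat.Properties as ℕ
  open import Data.Integer using (ℤ; +_; 0ℤ; 1ℤ; _+_; _*_; _-_)
  import Data.Integer.Properties as ℤ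
  open import Data.Integer.Tactic.RingSolver using (solve-∀)
  open import Data.Vec using ([]; _∷_)
  open import Relation.Binary.PropositionalEquality
  open ≡-Reasoning

  X : ∀ {n} → Word n → ℤ
  X []          = 1ℤ
  X (false ∷ u) = X u + 1ℤ
  X (true  ∷ u) = X u - 1ℤ

  -- As X = G 2, this expresses the product of the ball of radius 1 with that of radius s.
  G-recurrence : ∀ {n} s (u : Word n) →
    X u * G (suc s) u ≡ + suc s * G (suc (suc s)) u + (+ n - + s) * G s u
  G-recurrence zero [] = refl
  G-recurrence (suc s) [] = lemma (+ s)
    where
    lemma : ∀ s → 1ℤ * 1ℤ ≡ (1ℤ + (1ℤ + s)) * 1ℤ + (0ℤ - (1ℤ + s)) * 1ℤ
    lemma = solve-∀
  G-recurrence {suc n} zero (false ∷ u) = begin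
    (X u + 1ℤ) * (G 1 u + 0ℤ)                               ≡⟨ expand (X u) (G 1 u) ⟩
    X u * G 1 u + G 1 u                                     ≡⟨ cong (_+ G 1 u) (G-recurrence 0 u) ⟩
    1ℤ * G 2 u + (+ n - 0ℤ) * 0ℤ + G 1 u                    ≡⟨ collect (+ n) (G 1 u) (G 2 u) ⟩
    1ℤ * (G 2 u + G 1 u) + ((1ℤ + + n) - 0ℤ) * 0ℤ           ∎
    where
    expand : ∀ x a → (x + 1ℤ) * (a + 0ℤ) ≡ x * a + a
    expand = solve-∀
    collect : ∀ n a b → 1ℤ * b + (n - 0ℤ) * 0ℤ + a ≡ 1ℤ * (b + a) + ((1ℤ + n) - 0ℤ) * 0ℤ
    collect = solve-∀
  G-recurrence {suc n} zero (true ∷ u) = begin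
    (X u - 1ℤ) * (G 1 u - 0ℤ)                               ≡⟨ expand (X u) (G 1 u) ⟩
    X u * G 1 u - G 1 u                                     ≡⟨ cong (_- G 1 u) (G-recurrence 0 u) ⟩
    1ℤ * G 2 u + (+ n - 0ℤ) * 0ℤ - G 1 u                    ≡⟨ collect (+ n) (G 1 u) (G 2 u) ⟩
    1ℤ * (G 2 u - G 1 u) + ((1ℤ + + n) - 0ℤ) * 0ℤ           ∎
    where
    expand : ∀ x a → (x - 1ℤ) * (a - 0ℤ) ≡ x * a - a
    expand = solve-∀
    collect : ∀ n a b → 1ℤ * b + (n - 0ℤ) * 0ℤ - a ≡ 1ℤ * (b - a) + ((1ℤ + n) - 0ℤ) * 0ℤ
    collect = solve-∀
  G-recurrence {suc n} (suc s) (false ∷ u) = begin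
    (X u + 1ℤ) * (G (2 ℕ.+ s) u + G (suc s) u)
      ≡⟨ expand (X u) (G (2 ℕ.+ s) u) (G (suc s) u) ⟩
    X u * G (2 ℕ.+ s) u + X u * G (suc s) u + (G (2 ℕ.+ s) u + G (suc s) u)
      ≡⟨ cong (_+ (G (2 ℕ.+ s) u + G (suc s) u)) (cong₂ _+_ (G-recurrence (suc s) u) (G-recurrence s u)) ⟩
    _ ≡⟨ collect (+ n) (+ s) (G (3 ℕ.+ s) u) (G (2 ℕ.+ s) u) (G (suc s) u) (G s u) ⟩
    _ ∎
    where
    expand : ∀ x a b → (x + 1ℤ) * (a + b) ≡ x * a + x * b + (a + b)
    expand = solve-∀
    collect : ∀ n s a b c d →
      ((1ℤ + (1ℤ + s)) * a + (n - (1ℤ + s)) * c) + ((1ℤ + s) * b + (n - s) * d) + (b + c) ≡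
      (1ℤ + (1ℤ + s)) * (a + b) + ((1ℤ + n) - (1ℤ + s)) * (c + d)
    collect = solve-∀
  G-recurrence {suc n} (suc s) (true ∷ u) = begin
    (X u - 1ℤ) * (G (2 ℕ.+ s) u - G (suc s) u)
      ≡⟨ expand (X u) (G (2 ℕ.+ s) u) (G (suc s) u) ⟩
    X u * G (2 ℕ.+ s) u - X u * G (suc s) u + (G (suc s) u - G (2 ℕ.+ s) u)
      ≡⟨ cong (_+ (G (suc s) u - G (2 ℕ.+ s) u)) (cong₂ _-_ (G-recurrence (suc s) u) (G-recurrence s u)) ⟩
    _ ≡⟨ collect (+ n) (+ s) (G (3 ℕ.+ s) u) (G (2 ℕ.+ s) u) (G (suc s) u) (G s u) ⟩
    _ ∎
    where
    expand : ∀ x a b → (x - 1ℤ) * (a - b) ≡ x * a - x * b + (b - a)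
    expand = solve-∀
    collect : ∀ n s a b c d →
      ((1ℤ + (1ℤ + s)) * a + (n - (1ℤ + s)) * c) - ((1ℤ + s) * b + (n - s) * d) + (c - b) ≡
      (1ℤ + (1ℤ + s)) * (a - b) + ((1ℤ + n) - (1ℤ + s)) * (c - d)
    collect = solve-∀

  falses trues : ∀ {n} → Word n → ℕ
  falses []          = 0
  falses (false ∷ u) = suc (falses u)
  falses (true  ∷ u) = falses u
  trues []          = 0
  trues (false ∷ u) = trues u
  trues (true  ∷ u) = suc (trues u)

  falses+trues : ∀ {n} (u : Word n) → falses u ℕ.+ trues u ≡ n
  falses+trues []          = refl
  falses+trues (false ∷ u) = cong suc (falses+trues u)
  falses+trues (true  ∷ u) = trans (ℕ.+-suc (falses u) (trues u)) (cong suc (falses+trues u))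

  X-formula : ∀ {n} (u : Word n) → X u ≡ (1ℤ + + falses u) - + trues u
  X-formula []          = refl
  X-formula (false ∷ u) = trans (cong (_+ 1ℤ) (X-formula u)) (lemma (+ falses u) (+ trues u))
    where
    lemma : ∀ f t → (1ℤ + f) - t + 1ℤ ≡ (1ℤ + (1ℤ + f)) - t
    lemma = solve-∀
  X-formula (true ∷ u) = trans (cong (_- 1ℤ) (X-formula u)) (lemma (+ falses u) (+ trues u))
    where
    lemma : ∀ f t → (1ℤ + f) - t - 1ℤ ≡ (1ℤ + f) - (1ℤ + t)
    lemma = solve-∀

  X-nonzero : ∀ {n} (u : Word n) {j} → trues u ≡ suc j → X u ≡ + falses u - + j
  X-nonzero u {j} eq = begin
    X u                              ≡⟨ X-formula u ⟩
    (1ℤ + + falses u) - + trues u    ≡⟨ cong (λ k → (1ℤ + + falses u) - + k) eq ⟩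
    (1ℤ + + falses u) - (1ℤ + + j)   ≡⟨ lemma (+ falses u) (+ j) ⟩
    + falses u - + j                 ∎
    where
    lemma : ∀ i j → (1ℤ + i) - (1ℤ + j) ≡ i - j
    lemma = solve-∀

  length-nonzero : ∀ {n} (u : Word n) {j} → trues u ≡ suc j → n ≡ suc (falses u ℕ.+ j)
  length-nonzero u {j} eq = begin
    _                          ≡⟨ sym (falses+trues u) ⟩
    falses u ℕ.+ trues u       ≡⟨ cong (falses u ℕ.+_) eq ⟩
    falses u ℕ.+ suc j         ≡⟨ ℕ.+-suc (falses u) j ⟩
    suc (falses u ℕ.+ j)       ∎

  trues-0 : ∀ {n} (u : Word n) → trues u ≡ 0 → u ≡ 𝟎
  trues-0 []          _  = refl
  trues-0 (false ∷ u) eq = cong (false ∷_) (trues-0 u eq)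

  G-stable : ∀ {n} s (u : Word n) → n ℕ.< s → G (suc s) u ≡ G s u
  G-stable (suc s) []          _         = refl
  G-stable (suc s) (false ∷ u) (s≤s n<s) = cong₂ _+_ (G-stable (suc s) u (ℕ.m<n⇒m<1+n n<s)) (G-stable s u n<s)
  G-stable (suc s) (true ∷ u)  (s≤s n<s) = cong₂ _-_ (G-stable (suc s) u (ℕ.m<n⇒m<1+n n<s)) (G-stable s u n<s)

  -- From radius n on, the ball is the whole cube, over which a nontrivial character sums to zero.
  G-vanish : ∀ {n} s (u : Word n) {j} → trues u ≡ suc j → n ℕ.< s → G s u ≡ 0ℤ
  G-vanish (suc s) (false ∷ u) eq (s≤s n<s) =
    cong₂ _+_ (G-vanish (suc s) u eq (ℕ.m<n⇒m<1+n n<s)) (G-vanish s u eq n<s)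
  G-vanish (suc s) (true ∷ u) _ (s≤s n<s) =
    trans (cong (_- G s u) (G-stable s u n<s)) (ℤ.+-inverseʳ (G s u))

  sumTo : ℕ → (ℕ → ℤ) → ℤ
  sumTo zero    f = 0ℤ
  sumTo (suc k) f = sumTo k f + f k

  sumTo-cong : ∀ k {f g : ℕ → ℤ} → (∀ t → f t ≡ g t) → sumTo k f ≡ sumTo k g
  sumTo-cong zero    p = refl
  sumTo-cong (suc k) p = cong₂ _+_ (sumTo-cong k p) (p k)

  spectrum : ∀ {n} → ℕ → Word n → ℤ
  spectrum k u = sumTo k λ t → G (suc t) u * G (suc t) u

  adjacent : ∀ {n} → ℕ → Word n → ℤ
  adjacent k u = sumTo k λ t → G (suc t) u * G t u

  -- The recurrence gives `G (t + 1) * G t` the coefficient t from one square and n - t from the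
  -- next, so t cancels and only n and a boundary term remain.
  X*spectrum : ∀ {n} k (u : Word n) →
    X u * spectrum k u ≡ + n * adjacent k u + + k * (G (suc k) u * G k u)
  X*spectrum {n} zero u = lemma (X u) (+ n) (G 1 u * 0ℤ)
    where
    lemma : ∀ x n g → x * 0ℤ ≡ n * 0ℤ + 0ℤ * g
    lemma = solve-∀
  X*spectrum {n} (suc k) u = begin
    X u * (spectrum k u + g * g)
      ≡⟨ expand (X u) (spectrum k u) g ⟩
    X u * spectrum k u + X u * g * g
      ≡⟨ cong₂ (λ p q → p + q * g) (X*spectrum k u) (G-recurrence k u) ⟩
    (+ n * adjacent k u + + k * (g * G k u)) + (+ suc k * G (2 ℕ.+ k) u + (+ n - + k) * G k u) * g
      ≡⟨ collect (+ n) (+ k) (adjacent k u) g (G k u) (G (2 ℕ.+ k) u) ⟩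
    + n * (adjacent k u + g * G k u) + + suc k * (G (2 ℕ.+ k) u * g) ∎
    where
    g = G (suc k) u
    expand : ∀ x c g → x * (c + g * g) ≡ x * c + x * g * g
    expand = solve-∀
    collect : ∀ n k b g g⁻ g⁺ → (n * b + k * (g * g⁻)) + ((1ℤ + k) * g⁺ + (n - k) * g⁻) * g ≡
                                n * (b + g * g⁻) + (1ℤ + k) * (g⁺ * g)
    collect = solve-∀

  -- Expansion of (`G (t + 1)` + `G t`)². As `G 0` is zero, the shifted squares form a spectrum
  -- shorter by one.
  spectrum-false : ∀ {n} k (u : Word n) →
    spectrum (suc k) (false ∷ u) ≡ spectrum (suc k) u + spectrum k u + + 2 * adjacent (suc k) u
  spectrum-false zero u = lemma (G 1 u)
    where
    lemma : ∀ g → 0ℤ + (g + 0ℤ) * (g + 0ℤ) ≡ (0ℤ + g * g) + 0ℤ + + 2 * (0ℤ + g * 0ℤ)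
    lemma = solve-∀
  spectrum-false (suc k) u = trans (cong (_+ (G (2 ℕ.+ k) u + G (suc k) u) * (G (2 ℕ.+ k) u + G (suc k) u)) (spectrum-false k u))
    (lemma (spectrum k u) (adjacent (suc k) u) (G (suc k) u) (G (2 ℕ.+ k) u))
    where
    lemma : ∀ c b g g⁺ → ((c + g * g) + c + + 2 * b) + (g⁺ + g) * (g⁺ + g) ≡
                         ((c + g * g) + g⁺ * g⁺) + (c + g * g) + + 2 * (b + g⁺ * g)
    lemma = solve-∀

  spectrum-true : ∀ {n} k (u : Word n) →
    spectrum (suc k) (true ∷ u) ≡ spectrum (suc k) u + spectrum k u - + 2 * adjacent (suc k) u
  spectrum-true zero u = lemma (G 1 u)
    where
    lemma : ∀ g → 0ℤ + (g - 0ℤ) * (g - 0ℤ) ≡ (0ℤ + g * g) + 0ℤ - + 2 * (0ℤ + g * 0ℤ)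
    lemma = solve-∀
  spectrum-true (suc k) u = trans (cong (_+ (G (2 ℕ.+ k) u - G (suc k) u) * (G (2 ℕ.+ k) u - G (suc k) u)) (spectrum-true k u))
    (lemma (spectrum k u) (adjacent (suc k) u) (G (suc k) u) (G (2 ℕ.+ k) u))
    where
    lemma : ∀ c b g g⁺ → ((c + g * g) + c - + 2 * b) + (g⁺ - g) * (g⁺ - g) ≡
                         ((c + g * g) + g⁺ * g⁺) + (c + g * g) - + 2 * (b + g⁺ * g)
    lemma = solve-∀

  module _ {n k} (u : Word n) {j} (nz : trues u ≡ suc j) (n≤k : n ℕ.≤ k) where

    private
      vanish : G (suc k) u ≡ 0ℤ
      vanish = G-vanish (suc k) u nz (s≤s n≤k)

    spectrum-stable : spectrum (suc k) u ≡ spectrum k u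
    spectrum-stable = trans (cong (λ g → spectrum k u + g * g) vanish) (ℤ.+-identityʳ _)

    adjacent-stable : adjacent (suc k) u ≡ adjacent k u
    adjacent-stable = trans (cong (λ g → adjacent k u + g * G k u) vanish) (ℤ.+-identityʳ _)

    n*adjacent : + n * adjacent k u ≡ X u * spectrum k u
    n*adjacent = sym (begin
      X u * spectrum k u                               ≡⟨ X*spectrum k u ⟩
      + n * adjacent k u + + k * (G (suc k) u * G k u) ≡⟨ cong (λ g → + n * adjacent k u + + k * (g * G k u)) vanish ⟩
      + n * adjacent k u + + k * 0ℤ                    ≡⟨ cong (_+_ (+ n * adjacent k u)) (ℤ.*-zeroʳ (+ k)) ⟩
      + n * adjacent k u + 0ℤ                          ≡⟨ ℤ.+-identityʳ _ ⟩
      + n * adjacent k u                               ∎)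

    -- Here n + X = 2i + 1 with i the number of zeros of u, so each further zero contributes the
    -- next odd factor of a double factorial. In `n*spectrum-true`, n - X = 2j + 1 does the same for
    -- the ones.
    n*spectrum-false : + n * spectrum (suc k) (false ∷ u) ≡ + 2 * (+ n + X u) * spectrum k u
    n*spectrum-false = begin
      + n * spectrum (suc k) (false ∷ u)
        ≡⟨ cong (+ n *_) (spectrum-false k u) ⟩
      + n * (spectrum (suc k) u + spectrum k u + + 2 * adjacent (suc k) u)
        ≡⟨ cong₂ (λ c b → + n * (c + spectrum k u + + 2 * b)) spectrum-stable adjacent-stable ⟩
      + n * (spectrum k u + spectrum k u + + 2 * adjacent k u)
        ≡⟨ expand (+ n) (spectrum k u) (adjacent k u) ⟩
      + 2 * (+ n * spectrum k u + + n * adjacent k u)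
        ≡⟨ cong (λ b → + 2 * (+ n * spectrum k u + b)) n*adjacent ⟩
      + 2 * (+ n * spectrum k u + X u * spectrum k u)
        ≡⟨ collect (+ n) (X u) (spectrum k u) ⟩
      + 2 * (+ n + X u) * spectrum k u ∎
      where
      expand : ∀ n c b → n * (c + c + + 2 * b) ≡ + 2 * (n * c + n * b)
      expand = solve-∀
      collect : ∀ n x c → + 2 * (n * c + x * c) ≡ + 2 * (n + x) * c
      collect = solve-∀

    n*spectrum-true : + n * spectrum (suc k) (true ∷ u) ≡ + 2 * (+ n - X u) * spectrum k u
    n*spectrum-true = begin
      + n * spectrum (suc k) (true ∷ u)
        ≡⟨ cong (+ n *_) (spectrum-true k u) ⟩
      + n * (spectrum (suc k) u + spectrum k u - + 2 * adjacent (suc k) u)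
        ≡⟨ cong₂ (λ c b → + n * (c + spectrum k u - + 2 * b)) spectrum-stable adjacent-stable ⟩
      + n * (spectrum k u + spectrum k u - + 2 * adjacent k u)
        ≡⟨ expand (+ n) (spectrum k u) (adjacent k u) ⟩
      + 2 * (+ n * spectrum k u - + n * adjacent k u)
        ≡⟨ cong (λ b → + 2 * (+ n * spectrum k u - b)) n*adjacent ⟩
      + 2 * (+ n * spectrum k u - X u * spectrum k u)
        ≡⟨ collect (+ n) (X u) (spectrum k u) ⟩
      + 2 * (+ n - X u) * spectrum k u ∎
      where
      expand : ∀ n c b → n * (c + c - + 2 * b) ≡ + 2 * (n * c - n * b)
      expand = solve-∀
      collect : ∀ n x c → + 2 * (n * c - x * c) ≡ + 2 * (n - x) * c
      collect = solve-∀

  -- The double factorial (2i - 1)!!.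
  γ : ℕ → ℕ
  γ zero    = 1
  γ (suc i) = suc (2 ℕ.* i) ℕ.* γ i

  -- Terms with t ≥ n vanish for u ≠ 0, so any cutoff k ≥ n is allowed; this freedom lets the
  -- induction lengthen the word and the sum together.
  SpectrumFormula : ∀ {n} → Word n → ℕ → Set
  SpectrumFormula {n} u j = ∀ k → n ℕ.≤ k →
    + ((falses u ℕ.+ j) !) * spectrum k u ≡ + (2 ℕ.^ (falses u ℕ.+ j)) * (+ γ (falses u) * + γ j)

  private
    pos-suc-2* : ∀ i → + suc (2 ℕ.* i) ≡ 1ℤ + + 2 * + i
    pos-suc-2* i = cong (_+_ 1ℤ) (ℤ.pos-* 2 i)

    pos-γ-suc : ∀ i → + γ (suc i) ≡ (1ℤ + + 2 * + i) * + γ i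
    pos-γ-suc i = trans (ℤ.pos-* (suc (2 ℕ.* i)) (γ i)) (cong (_* + γ i) (pos-suc-2* i))

  formula-false : ∀ {n} (u : Word n) {j} → trues u ≡ suc j → SpectrumFormula u j → SpectrumFormula (false ∷ u) j
  formula-false {n} u {j} nz hyp (suc k) (s≤s n≤k) = begin
    + (suc m !) * c′                            ≡⟨ cong (_* c′) (ℤ.pos-* (suc m) (m !)) ⟩
    + suc m * + (m !) * c′                      ≡⟨ cong (λ p → + p * + (m !) * c′) (sym n≡) ⟩
    + n * + (m !) * c′                          ≡⟨ swap (+ n) (+ (m !)) c′ ⟩
    + (m !) * (+ n * c′)                        ≡⟨ cong (+ (m !) *_) (n*spectrum-false u nz n≤k) ⟩
    + (m !) * (+ 2 * (+ n + X u) * c)           ≡⟨ cong₂ (λ p x → + (m !) * (+ 2 * (+ p + x) * c)) n≡ (X-nonzero u nz) ⟩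
    + (m !) * (+ 2 * ((1ℤ + (+ i + + j)) + (+ i - + j)) * c)
                                                ≡⟨ simplify (+ (m !)) (+ i) (+ j) c ⟩
    + 2 * ((1ℤ + + 2 * + i)) * (+ (m !) * c)    ≡⟨ cong (+ 2 * (1ℤ + + 2 * + i) *_) (hyp k n≤k) ⟩
    + 2 * ((1ℤ + + 2 * + i)) * (P * (+ γ i * + γ j))
                                                ≡⟨ regroup P (1ℤ + + 2 * + i) (+ γ i) (+ γ j) ⟩
    (+ 2 * P) * ((1ℤ + + 2 * + i) * + γ i * + γ j)
                                                ≡⟨ cong₂ (λ p q → p * (q * + γ j)) (sym (ℤ.pos-* 2 (2 ℕ.^ m))) (sym (pos-γ-suc i)) ⟩
    + (2 ℕ.^ suc m) * (+ γ (suc i) * + γ j)     ∎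
    where
    i = falses u
    m = i ℕ.+ j
    P = + (2 ℕ.^ m)
    c = spectrum k u
    c′ = spectrum (suc k) (false ∷ u)
    n≡ = length-nonzero u nz
    swap : ∀ a b c → a * b * c ≡ b * (a * c)
    swap = solve-∀
    simplify : ∀ f i j c → f * (+ 2 * ((1ℤ + (i + j)) + (i - j)) * c) ≡ + 2 * ((1ℤ + + 2 * i)) * (f * c)
    simplify = solve-∀
    regroup : ∀ p q a b → + 2 * q * (p * (a * b)) ≡ (+ 2 * p) * (q * a * b)
    regroup = solve-∀

  formula-true : ∀ {n} (u : Word n) {j} → trues u ≡ suc j → SpectrumFormula u j → SpectrumFormula (true ∷ u) (suc j)
  formula-true {n} u {j} nz hyp (suc k) (s≤s n≤k) = begin
    + ((i ℕ.+ suc j) !) * c′                    ≡⟨ cong (λ p → + (p !) * c′) (ℕ.+-suc i j) ⟩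
    + (suc m !) * c′                            ≡⟨ cong (_* c′) (ℤ.pos-* (suc m) (m !)) ⟩
    + suc m * + (m !) * c′                      ≡⟨ cong (λ p → + p * + (m !) * c′) (sym n≡) ⟩
    + n * + (m !) * c′                          ≡⟨ swap (+ n) (+ (m !)) c′ ⟩
    + (m !) * (+ n * c′)                        ≡⟨ cong (+ (m !) *_) (n*spectrum-true u nz n≤k) ⟩
    + (m !) * (+ 2 * (+ n - X u) * c)           ≡⟨ cong₂ (λ p x → + (m !) * (+ 2 * (+ p - x) * c)) n≡ (X-nonzero u nz) ⟩
    + (m !) * (+ 2 * ((1ℤ + (+ i + + j)) - (+ i - + j)) * c)
                                                ≡⟨ simplify (+ (m !)) (+ i) (+ j) c ⟩
    + 2 * ((1ℤ + + 2 * + j)) * (+ (m !) * c)    ≡⟨ cong (+ 2 * (1ℤ + + 2 * + j) *_) (hyp k n≤k) ⟩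
    + 2 * ((1ℤ + + 2 * + j)) * (P * (+ γ i * + γ j))
                                                ≡⟨ regroup P (1ℤ + + 2 * + j) (+ γ i) (+ γ j) ⟩
    (+ 2 * P) * (+ γ i * ((1ℤ + + 2 * + j) * + γ j))
                                                ≡⟨ cong₂ (λ p q → p * (+ γ i * q)) (sym (ℤ.pos-* 2 (2 ℕ.^ m))) (sym (pos-γ-suc j)) ⟩
    + (2 ℕ.^ suc m) * (+ γ i * + γ (suc j))     ≡⟨ cong (λ p → + (2 ℕ.^ p) * (+ γ i * + γ (suc j))) (sym (ℕ.+-suc i j)) ⟩
    + (2 ℕ.^ (i ℕ.+ suc j)) * (+ γ i * + γ (suc j)) ∎
    where
    i = falses u
    m = i ℕ.+ j
    P = + (2 ℕ.^ m)
    c = spectrum k u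
    c′ = spectrum (suc k) (true ∷ u)
    n≡ = length-nonzero u nz
    swap : ∀ a b c → a * b * c ≡ b * (a * c)
    swap = solve-∀
    simplify : ∀ f i j c → f * (+ 2 * ((1ℤ + (i + j)) - (i - j)) * c) ≡ + 2 * ((1ℤ + + 2 * j)) * (f * c)
    simplify = solve-∀
    regroup : ∀ p q a b → + 2 * q * (p * (a * b)) ≡ (+ 2 * p) * (a * (q * b))
    regroup = solve-∀

  -- An instance of the eigenvalue depending on the weight of the word only.
  G-swap : ∀ {n} s (u : Word n) → G s (true ∷ false ∷ u) ≡ G s (false ∷ true ∷ u)
  G-swap zero          u = refl
  G-swap (suc zero)    u = lemma (G 1 u)
    where
    lemma : ∀ a → (a + 0ℤ) - 0ℤ ≡ (a - 0ℤ) + 0ℤ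
    lemma = solve-∀
  G-swap (suc (suc s)) u = lemma (G (2 ℕ.+ s) u) (G (suc s) u) (G s u)
    where
    lemma : ∀ a b c → (a + b) - (b + c) ≡ (a - b) + (b - c)
    lemma = solve-∀

  -- The induction step cannot start from `𝟎`, where large balls do not have eigenvalue zero. Words
  -- of weight one are instead grown from `true ∷ []` by prefixing zeros, and `G-swap` carries the
  -- one back to the front.
  formula-weight-1 : ∀ n → SpectrumFormula (true ∷ 𝟎 {n}) 0
  formula-weight-1 zero (suc zero)    _ = refl
  formula-weight-1 zero (suc (suc k)) _ = trans
    (cong (1ℤ *_) (spectrum-stable (true ∷ []) refl (s≤s (z≤n {k})))) (formula-weight-1 zero (suc k) (s≤s z≤n))
  formula-weight-1 (suc n) k n≤k = trans
    (cong (+ ((falses (𝟎 {suc n}) ℕ.+ 0) !) *_)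
      (sumTo-cong k λ t → cong (λ g → g * g) (G-swap (suc t) (𝟎 {n}))))
    (formula-false (true ∷ 𝟎 {n}) (cong suc (trues-𝟎 n)) (formula-weight-1 n) k n≤k)
    where
    trues-𝟎 : ∀ n → trues (𝟎 {n}) ≡ 0
    trues-𝟎 zero    = refl
    trues-𝟎 (suc n) = trues-𝟎 n

  spectrum-formula : ∀ {n} (u : Word n) {j} → trues u ≡ suc j → SpectrumFormula u j
  spectrum-formula (false ∷ u) nz = formula-false u nz (spectrum-formula u nz)
  spectrum-formula (true ∷ u) {zero} nz =
    subst (λ w → SpectrumFormula (true ∷ w) 0) (sym (trues-0 u (ℕ.suc-injective nz))) (formula-weight-1 _)
  spectrum-formula (true ∷ u) {suc j} nz =
    formula-true u (ℕ.suc-injective nz) (spectrum-formula u (ℕ.suc-injective nz))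

-- Even moments of the power spectrum are minimised by a perfect code

module EvenMoments where

  open WalshTransform
  open BallSpectrum
  open import Data.Bool using (true; false; if_then_else_)
  open import Data.Empty using (⊥)
  open import Data.Unit using (⊤; tt)
  open import Data.Sum using (inj₁; inj₂)
  open import Data.Nat as ℕ using (ℕ; zero; suc; s≤s; z≤n; _≤?_)
  import Data.Nat.Properties as ℕ
  open import Data.Integer using (ℤ; +_; -[1+_]; 0ℤ; 1ℤ; _+_; _*_; _-_; -_; _^_; ∣_∣; _≤_; +≤+)
  import Data.Integer.Properties as ℤ
  open import Data.Integer.Tactic.RingSolver using (solve-∀)
  open import Data.Vec using ([]; _∷_)
  open import Data.List using (List; []; _∷_; length)
  open import Relation.Nullary using (¬_; yes; no)
  open import Relation.Nullary.Decidable using (dec-true; dec-false)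
  open import Relation.Binary.PropositionalEquality
  open ≡-Reasoning

  within-yes : ∀ {n} {t} (x z : Word n) → hamming x z ℕ.≤ t → within t x z ≡ 1
  within-yes {t = t} x z p = cong (if_then 1 else 0) (dec-true (hamming x z ≤? t) p)

  within-no : ∀ {n} {t} (x z : Word n) → ¬ hamming x z ℕ.≤ t → within t x z ≡ 0
  within-no {t = t} x z ¬p = cong (if_then 1 else 0) (dec-false (hamming x z ≤? t) ¬p)

  within-mono : ∀ {n} {s t} → s ℕ.≤ t → (x z : Word n) → within s x z ℕ.≤ within t x z
  within-mono {s = s} s≤t x z with hamming x z ≤? s
  ... | no ¬p = ℕ.≤-trans (ℕ.≤-reflexive (within-no x z ¬p)) z≤n
  ... | yes p = ℕ.≤-reflexive (trans (within-yes x z p) (sym (within-yes x z (ℕ.≤-trans p s≤t))))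

  countIn-mono : ∀ {n} {s t} → s ℕ.≤ t → (x : Word n) (Z : List (Word n)) → countIn x s Z ℕ.≤ countIn x t Z
  countIn-mono s≤t x []      = z≤n
  countIn-mono {s = s} {t} s≤t x (z ∷ Z) = subst₂ ℕ._≤_ (sym (countIn-∷ x s z Z)) (sym (countIn-∷ x t z Z))
    (ℕ.+-mono-≤ (within-mono s≤t x z) (countIn-mono s≤t x Z))

  hamming≤n : ∀ {n} (x z : Word n) → hamming x z ℕ.≤ n
  hamming≤n []          []          = z≤n
  hamming≤n (false ∷ x) (false ∷ z) = ℕ.m≤n⇒m≤1+n (hamming≤n x z)
  hamming≤n (false ∷ x) (true  ∷ z) = s≤s (hamming≤n x z)
  hamming≤n (true  ∷ x) (false ∷ z) = s≤s (hamming≤n x z)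
  hamming≤n (true  ∷ x) (true  ∷ z) = ℕ.m≤n⇒m≤1+n (hamming≤n x z)

  within-⊓ : ∀ {n} t (x z : Word n) → within (t ℕ.⊓ n) x z ≡ within t x z
  within-⊓ {n} t x z with hamming x z ≤? t
  ... | yes p = trans (within-yes x z (ℕ.⊓-glb p (hamming≤n x z))) (sym (within-yes x z p))
  ... | no ¬p = trans (within-no x z (λ q → ¬p (ℕ.≤-trans q (ℕ.m⊓n≤m t n)))) (sym (within-no x z ¬p))

  -- No distance exceeds n, so the radius of a perfect code may be cut down to at most n.
  countIn-⊓ : ∀ {n} t (x : Word n) Z → countIn x (t ℕ.⊓ n) Z ≡ countIn x t Z
  countIn-⊓ t x []      = refl
  countIn-⊓ {n} t x (z ∷ Z) = begin
    countIn x (t ℕ.⊓ n) (z ∷ Z)                      ≡⟨ countIn-∷ x (t ℕ.⊓ n) z Z ⟩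
    within (t ℕ.⊓ n) x z ℕ.+ countIn x (t ℕ.⊓ n) Z   ≡⟨ cong₂ ℕ._+_ (within-⊓ t x z) (countIn-⊓ t x Z) ⟩
    within t x z ℕ.+ countIn x t Z                   ≡⟨ sym (countIn-∷ x t z Z) ⟩
    countIn x t (z ∷ Z)                              ∎

  volume : ℕ → ℕ → ℤ
  volume n t = G (suc t) (𝟎 {n})

  -- The discrepancy of the ball B(x,t), scaled by N 2ⁿ.
  deviation : ∀ {n} → List (Word n) → ℕ → Word n → ℤ
  deviation {n} Z t x = + (2 ℕ.^ n) * + countIn x t Z + - (+ length Z) * volume n t

  -- The function h of the overview; `wave` is its transform and `power` the square of that.
  signed : ∀ {n} → List (Word n) → Word n → ℤ
  signed {n} Z x = + (2 ℕ.^ n) * mult Z x + - (+ length Z)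

  ball-signed : ∀ {n} (Z : List (Word n)) t x → ball (suc t) (signed Z) x ≡ deviation Z t x
  ball-signed {n} Z t x = trans (ball-affine (suc t) (+ (2 ℕ.^ n)) (- (+ length Z)) (mult Z) x)
    (cong (λ c → + (2 ℕ.^ n) * c + - (+ length Z) * volume n t) (ball-mult t Z x))

  wave : ∀ {n} → List (Word n) → Word n → ℤ
  wave Z = hat (signed Z)

  power : ∀ {n} → List (Word n) → Word n → ℤ
  power Z u = wave Z u * wave Z u

  ∑-deviation² : ∀ {n} (Z : List (Word n)) i j →
    ∑ (λ u → (G (suc i) u * G (suc j) u) * power Z u) ≡ + (2 ℕ.^ n) * ∑ (λ x → deviation Z i x * deviation Z j x)
  ∑-deviation² {n} Z i j = begin
    ∑ (λ u → (G (suc i) u * G (suc j) u) * power Z u)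
      ≡⟨ ∑-cong (λ u → swap (G (suc i) u) (G (suc j) u) (wave Z u)) ⟩
    ∑ (λ u → (G (suc i) u * wave Z u) * (G (suc j) u * wave Z u))
      ≡⟨ ∑-cong (λ u → cong₂ _*_ (transform i u) (transform j u)) ⟩
    ∑ (λ u → hat (deviation Z i) u * hat (deviation Z j) u)
      ≡⟨ parseval (deviation Z i) (deviation Z j) ⟩
    + (2 ℕ.^ n) * ∑ (λ x → deviation Z i x * deviation Z j x) ∎
    where
    swap : ∀ a b h → (a * b) * (h * h) ≡ (a * h) * (b * h)
    swap = solve-∀
    transform : ∀ t u → G (suc t) u * wave Z u ≡ hat (deviation Z t) u
    transform t u = trans (sym (hat-ball (suc t) (signed Z) u)) (hat-cong (ball-signed Z t) u)

  -- Subtracting N makes h sum to zero. This removes the trivial character, to which the spectral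
  -- formula does not apply.
  wave-𝟎 : ∀ {n} (Z : List (Word n)) → wave Z 𝟎 ≡ 0ℤ
  wave-𝟎 {n} Z = begin
    wave Z 𝟎                                   ≡⟨ hat-𝟎 (signed Z) ⟩
    ∑ (signed Z)                               ≡⟨ ∑-+ (λ x → P * mult Z x) (λ _ → - N) ⟩
    ∑ (λ x → P * mult Z x) + ∑ {n} (λ _ → - N) ≡⟨ cong₂ _+_ (∑-* P (mult Z)) (∑-const n (- N)) ⟩
    P * ∑ (mult Z) + P * - N                   ≡⟨ cong (λ s → P * s + P * - N) (∑-mult Z) ⟩
    P * N + P * - N                            ≡⟨ cancel P N ⟩
    0ℤ                                         ∎
    where
    P = + (2 ℕ.^ n)
    N = + length Z
    cancel : ∀ p q → p * q + p * - q ≡ 0ℤ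
    cancel = solve-∀

  -- The cross terms are sums of single ball counts, fixed by N through double counting. Between
  -- codes of equal size only the correlation of the counts can differ.
  ∑-deviation*deviation : ∀ {n} (Z : List (Word n)) i j →
    ∑ (λ x → deviation Z i x * deviation Z j x) ≡
    + (2 ℕ.^ n) * + (2 ℕ.^ n) * ∑ (λ x → + countIn x i Z * + countIn x j Z)
      - + (2 ℕ.^ n) * (+ length Z * + length Z) * (volume n i * volume n j)
  ∑-deviation*deviation {n} Z i j = begin
    ∑ (λ x → deviation Z i x * deviation Z j x)
      ≡⟨ ∑-cong (λ x → expand P N (volume n i) (volume n j) (c i x) (c j x)) ⟩
    ∑ (λ x → (P * P * (c i x * c j x) + αⱼ * c i x) + (αᵢ * c j x + β))
      ≡⟨ ∑-+ (λ x → P * P * (c i x * c j x) + αⱼ * c i x) (λ x → αᵢ * c j x + β) ⟩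
    ∑ (λ x → P * P * (c i x * c j x) + αⱼ * c i x) + ∑ (λ x → αᵢ * c j x + β)
      ≡⟨ cong₂ _+_ (∑-+ (λ x → P * P * (c i x * c j x)) (λ x → αⱼ * c i x)) (∑-+ (λ x → αᵢ * c j x) (λ _ → β)) ⟩
    (∑ (λ x → P * P * (c i x * c j x)) + ∑ (λ x → αⱼ * c i x)) + (∑ (λ x → αᵢ * c j x) + ∑ {n} (λ _ → β))
      ≡⟨ cong₂ _+_ (cong₂ _+_ (∑-* (P * P) (λ x → c i x * c j x)) (∑-* αⱼ (c i)))
                   (cong₂ _+_ (∑-* αᵢ (c j)) (∑-const n β)) ⟩
    (P * P * Q + αⱼ * ∑ (c i)) + (αᵢ * ∑ (c j) + P * β)
      ≡⟨ cong₂ (λ p q → (P * P * Q + αⱼ * p) + (αᵢ * q + P * β)) (∑-countIn i Z) (∑-countIn j Z) ⟩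
    (P * P * Q + αⱼ * (volume n i * N)) + (αᵢ * (volume n j * N) + P * β)
      ≡⟨ collect P N (volume n i) (volume n j) Q ⟩
    P * P * Q - P * (N * N) * (volume n i * volume n j) ∎
    where
    P = + (2 ℕ.^ n)
    N = + length Z
    αᵢ = - (P * N * volume n i)
    αⱼ = - (P * N * volume n j)
    β = N * N * (volume n i * volume n j)
    c : ℕ → Word n → ℤ
    c t x = + countIn x t Z
    Q = ∑ (λ x → c i x * c j x)
    expand : ∀ p n v w a b → (p * a + - n * v) * (p * b + - n * w) ≡
      (p * p * (a * b) + - (p * n * w) * a) + (- (p * n * v) * b + n * n * (v * w))
    expand = solve-∀
    collect : ∀ p n v w q →
      (p * p * q + - (p * n * w) * (v * n)) + (- (p * n * v) * (w * n) + p * (n * n * (v * w))) ≡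
      p * p * q - p * (n * n) * (v * w)
    collect = solve-∀

  Even : ℕ → Set
  Even zero          = ⊤
  Even (suc zero)    = ⊥
  Even (suc (suc k)) = Even k

  Even-double : ∀ r → Even (r ℕ.+ r)
  Even-double zero    = tt
  Even-double (suc r) = subst Even (cong suc (sym (ℕ.+-suc r r))) (Even-double r)

  Even-cancel : ∀ k e → Even (k ℕ.+ (e ℕ.+ e)) → Even k
  Even-cancel k zero    ev = subst Even (ℕ.+-identityʳ k) ev
  Even-cancel k (suc e) ev = Even-cancel k e (subst Even lemma ev)
    where
    lemma : k ℕ.+ (suc e ℕ.+ suc e) ≡ 2 ℕ.+ (k ℕ.+ (e ℕ.+ e))
    lemma = trans (ℕ.+-suc k (e ℕ.+ suc e)) (cong suc
      (trans (cong (k ℕ.+_) (ℕ.+-suc e e)) (ℕ.+-suc k (e ℕ.+ e))))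

  square-∣∣ : ∀ x → x * x ≡ + (∣ x ∣ ℕ.* ∣ x ∣)
  square-∣∣ (+ m)    = sym (ℤ.pos-* m m)
  square-∣∣ -[1+ m ] = refl

  0≤*  : ∀ {x y} → 0ℤ ≤ x → 0ℤ ≤ y → 0ℤ ≤ x * y
  0≤* {+ x} {+ y} _ _ = subst (0ℤ ≤_) (ℤ.pos-* x y) (+≤+ z≤n)

  0≤square : ∀ x → 0ℤ ≤ x * x
  0≤square x = subst (0ℤ ≤_) (sym (square-∣∣ x)) (+≤+ z≤n)

  0≤^even : ∀ x l → Even l → 0ℤ ≤ x ^ l
  0≤^even x zero          _  = +≤+ z≤n
  0≤^even x (suc (suc l)) ev = subst (0ℤ ≤_) (ℤ.*-assoc x x (x ^ l)) (0≤* (0≤square x) (0≤^even x l ev))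

  G-1 : ∀ {n} (u : Word n) → G 1 u ≡ 1ℤ
  G-1 []          = refl
  G-1 (false ∷ u) = cong (_+ 0ℤ) (G-1 u)
  G-1 (true  ∷ u) = cong (_- 0ℤ) (G-1 u)

  module Moments {n} (Z Z′ : List (Word n)) (e : ℕ) (e≤n : e ℕ.≤ n)
    (perfect : ∀ x → countIn x e Z ≡ 1) (same : length Z′ ≡ length Z) where

    record Dominated (φ : Word n → ℤ) : Set where
      constructor dominate
      field dominates : ∑ (λ u → φ u * power Z u) ≤ ∑ (λ u → φ u * power Z′ u)
    open Dominated public

    private
      P = + (2 ℕ.^ n)

      c c′ : ℕ → Word n → ℤ
      c t x = + countIn x t Z
      c′ t x = + countIn x t Z′

    dominated-cong : ∀ {φ ψ} → (∀ u → φ u ≡ ψ u) → Dominated φ → Dominated ψ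
    dominated-cong eq (dominate p) = dominate
      (subst₂ _≤_ (∑-cong λ u → cong (_* power Z u) (eq u)) (∑-cong λ u → cong (_* power Z′ u) (eq u)) p)

    dominated-+ : ∀ {φ ψ} → Dominated φ → Dominated ψ → Dominated (λ u → φ u + ψ u)
    dominated-+ {φ} {ψ} (dominate p) (dominate q) = dominate (subst₂ _≤_ (split Z) (split Z′) (ℤ.+-mono-≤ p q))
      where
      split : ∀ Y → ∑ (λ u → φ u * power Y u) + ∑ (λ u → ψ u * power Y u) ≡ ∑ (λ u → (φ u + ψ u) * power Y u)
      split Y = trans (sym (∑-+ (λ u → φ u * power Y u) (λ u → ψ u * power Y u)))
                      (∑-cong λ u → sym (ℤ.*-distribʳ-+ (power Y u) (φ u) (ψ u)))

    dominated-* : ∀ k {φ} → Dominated φ → Dominated (λ u → + k * φ u)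
    dominated-* k {φ} (dominate p) = dominate (subst₂ _≤_ (scale Z) (scale Z′) (ℤ.*-monoˡ-≤-nonNeg (+ k) p))
      where
      scale : ∀ Y → + k * ∑ (λ u → φ u * power Y u) ≡ ∑ (λ u → + k * φ u * power Y u)
      scale Y = trans (sym (∑-* (+ k) (λ u → φ u * power Y u)))
                      (∑-cong λ u → sym (ℤ.*-assoc (+ k) (φ u) (power Y u)))

    -- Integrality of the counts: p ≤ p q for naturals p ≤ q, with equality if q ≤ 1.
    ∑-counts : ∀ {i j} → i ℕ.≤ j → j ℕ.≤ e → ∑ (λ x → c i x * c j x) ≤ ∑ (λ x → c′ i x * c′ j x)
    ∑-counts {i} {j} i≤j j≤e = ℤ.≤-trans (∑-mono upper) (ℤ.≤-trans (ℤ.≤-reflexive equal) (∑-mono lower))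
      where
      upper : ∀ x → c i x * c j x ≤ c i x
      upper x = subst (_≤ c i x) (ℤ.pos-* (countIn x i Z) (countIn x j Z)) (+≤+
        (ℕ.≤-trans (ℕ.*-monoʳ-≤ (countIn x i Z) (ℕ.≤-trans (countIn-mono j≤e x Z) (ℕ.≤-reflexive (perfect x))))
                   (ℕ.≤-reflexive (ℕ.*-identityʳ _))))
      lemma : ∀ {p q} → p ℕ.≤ q → p ℕ.≤ p ℕ.* q
      lemma {zero}  _          = z≤n
      lemma {suc p} (s≤s {n = q} _) = ℕ.m≤m*n (suc p) (suc q)
      lower : ∀ x → c′ i x ≤ c′ i x * c′ j x
      lower x = subst (c′ i x ≤_) (ℤ.pos-* (countIn x i Z′) (countIn x j Z′)) (+≤+ (lemma (countIn-mono i≤j x Z′)))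
      equal : ∑ (c i) ≡ ∑ (c′ i)
      equal = begin
        ∑ (c i)                      ≡⟨ ∑-countIn i Z ⟩
        volume n i * + length Z      ≡⟨ cong (λ N → volume n i * + N) (sym same) ⟩
        volume n i * + length Z′     ≡⟨ sym (∑-countIn i Z′) ⟩
        ∑ (c′ i)                     ∎

    -- Parseval turns the product of eigenvalues into a correlation of deviations, and `∑-counts`
    -- compares the one part of it that depends on more than the size.
    dominated-GG : ∀ {i j} → i ℕ.≤ j → j ℕ.≤ e → Dominated (λ u → G (suc i) u * G (suc j) u)
    dominated-GG {i} {j} i≤j j≤e = dominate (subst₂ _≤_ (sym (∑-deviation² Z i j)) (sym (∑-deviation² Z′ i j))
      (ℤ.*-monoˡ-≤-nonNeg P (subst₂ _≤_ (sym (∑-deviation*deviation Z i j))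
        (sym (trans (∑-deviation*deviation Z′ i j)
          (cong (λ N → P * P * ∑ (λ x → c′ i x * c′ j x) - P * (+ N * + N) * (volume n i * volume n j)) same)))
        (ℤ.+-monoˡ-≤ _ (subst (λ q → q * ∑ (λ x → c i x * c j x) ≤ q * ∑ (λ x → c′ i x * c′ j x))
          (ℤ.pos-* (2 ℕ.^ n) (2 ℕ.^ n)) (ℤ.*-monoˡ-≤-nonNeg (+ (2 ℕ.^ n ℕ.* 2 ℕ.^ n)) (∑-counts i≤j j≤e)))))))

    sphere-packing : volume n e * + length Z ≡ P
    sphere-packing = begin
      volume n e * + length Z  ≡⟨ sym (∑-countIn e Z) ⟩
      ∑ (c e)                  ≡⟨ ∑-cong (λ x → cong +_ (perfect x)) ⟩
      ∑ {n} (λ _ → 1ℤ)         ≡⟨ ∑-const n 1ℤ ⟩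
      P * 1ℤ                   ≡⟨ ℤ.*-identityʳ P ⟩
      P                        ∎

    -- Lloyd's theorem: the spectrum of a perfect code lies on the zeros of G (e + 1).
    lloyd : ∀ u → G (suc e) u * wave Z u ≡ 0ℤ
    lloyd u = begin
      G (suc e) u * wave Z u               ≡⟨ sym (hat-ball (suc e) (signed Z) u) ⟩
      hat (ball (suc e) (signed Z)) u      ≡⟨ hat-cong vanish u ⟩
      hat (λ _ → 0ℤ) u                     ≡⟨ hat-0 u ⟩
      0ℤ                                   ∎
      where
      cancel : ∀ p n v → v * n ≡ p → p * 1ℤ + - n * v ≡ 0ℤ
      cancel p n v refl = ring v n
        where
        ring : ∀ v n → v * n * 1ℤ + - n * v ≡ 0ℤ
        ring = solve-∀
      vanish : ∀ x → ball (suc e) (signed Z) x ≡ 0ℤ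
      vanish x = begin
        ball (suc e) (signed Z) x                     ≡⟨ ball-signed Z e x ⟩
        P * c e x + - (+ length Z) * volume n e       ≡⟨ cong (λ k → P * + k + - (+ length Z) * volume n e) (perfect x) ⟩
        P * 1ℤ + - (+ length Z) * volume n e          ≡⟨ cancel P (+ length Z) (volume n e) sphere-packing ⟩
        0ℤ                                            ∎

    dominated-lloyd² : ∀ l → Even l → Dominated (λ u → X u ^ l * (G (suc e) u * G (suc e) u))
    dominated-lloyd² l ev = dominate (∑-mono λ u → ℤ.≤-trans (ℤ.≤-reflexive (zeroˡ u)) (nonneg u))
      where
      ring : ∀ x g h → x * (g * g) * (h * h) ≡ x * (g * h * (g * h))
      ring = solve-∀
      zeroˡ : ∀ u → X u ^ l * (G (suc e) u * G (suc e) u) * power Z u ≡ 0ℤ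
      zeroˡ u = trans (ring (X u ^ l) (G (suc e) u) (wave Z u))
        (trans (cong (λ y → X u ^ l * (y * y)) (lloyd u)) (ℤ.*-zeroʳ (X u ^ l)))
      nonneg : ∀ u → 0ℤ ≤ X u ^ l * (G (suc e) u * G (suc e) u) * power Z′ u
      nonneg u = 0≤* (0≤* (0≤^even (X u) l ev) (0≤square (G (suc e) u))) (0≤square (wave Z′ u))

    -- One X is absorbed into the second eigenvalue while `f` stays fixed. The bound i ≤ n makes the
    -- coefficient n - i of the recurrence nonnegative, without which domination would not be
    -- inherited.
    dominated-X* : ∀ l (f : Word n → ℤ) i → i ℕ.≤ n →
      Dominated (λ u → X u ^ l * (f u * G (suc (suc i)) u)) → Dominated (λ u → X u ^ l * (f u * G i u)) →
      Dominated (λ u → X u ^ suc l * (f u * G (suc i) u))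
    dominated-X* l f i i≤n up down = dominated-cong (λ u → sym (eq u))
      (dominated-+ (dominated-* (suc i) up) (dominated-* (n ℕ.∸ i) down))
      where
      expand : ∀ x p f g → x * p * (f * g) ≡ p * (f * (x * g))
      expand = solve-∀
      collect : ∀ p f a b g⁺ g⁻ → p * (f * (a * g⁺ + b * g⁻)) ≡ a * (p * (f * g⁺)) + b * (p * (f * g⁻))
      collect = solve-∀
      eq : ∀ u → X u ^ suc l * (f u * G (suc i) u) ≡
        + suc i * (X u ^ l * (f u * G (suc (suc i)) u)) + + (n ℕ.∸ i) * (X u ^ l * (f u * G i u))
      eq u = begin
        X u * X u ^ l * (f u * G (suc i) u)
          ≡⟨ expand (X u) (X u ^ l) (f u) (G (suc i) u) ⟩
        X u ^ l * (f u * (X u * G (suc i) u))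
          ≡⟨ cong (λ y → X u ^ l * (f u * y)) (G-recurrence i u) ⟩
        X u ^ l * (f u * (+ suc i * G (suc (suc i)) u + (+ n - + i) * G i u))
          ≡⟨ cong (λ y → X u ^ l * (f u * (+ suc i * G (suc (suc i)) u + y * G i u)))
               (trans (ℤ.m-n≡m⊖n n i) (ℤ.⊖-≥ i≤n)) ⟩
        X u ^ l * (f u * (+ suc i * G (suc (suc i)) u + + (n ℕ.∸ i) * G i u))
          ≡⟨ collect (X u ^ l) (f u) (+ suc i) (+ (n ℕ.∸ i)) (G (suc (suc i)) u) (G i u) ⟩
        _ ∎

    -- The lower end of the recurrence: `G 0` belongs to the empty ball.
    dominated-zero : ∀ l (f : Word n → ℤ) → Dominated (λ u → X u ^ l * (f u * G 0 u))
    dominated-zero l f = dominate (∑-mono λ u → ℤ.≤-reflexive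
      (trans (ring (X u ^ l) (f u) (power Z u)) (sym (ring (X u ^ l) (f u) (power Z′ u)))))
      where
      ring : ∀ x f p → x * (f * 0ℤ) * p ≡ 0ℤ
      ring = solve-∀

    private
      parity-up : ∀ l d i → Even (suc l ℕ.+ (d ℕ.+ i)) → Even (l ℕ.+ (d ℕ.+ suc i))
      parity-up l d i = subst Even (sym (trans (cong (l ℕ.+_) (ℕ.+-suc d i)) (ℕ.+-suc l (d ℕ.+ i))))

      parity-down : ∀ l d i → Even (suc l ℕ.+ (d ℕ.+ suc i)) → Even (l ℕ.+ (d ℕ.+ i))
      parity-down l d i = subst Even (cong suc (trans (cong (l ℕ.+_) (ℕ.+-suc d i)) (ℕ.+-suc l (d ℕ.+ i))))

    -- Multiplication by X acts on G 1, …, G e, G (e+1) G 1, …, G (e+1) G e with nonnegative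
    -- coefficients modulo G (e+1)², and reverses parity.
    dominated-upper : ∀ l i → i ℕ.≤ e → Even (l ℕ.+ (e ℕ.+ i)) → Dominated (λ u → X u ^ l * (G (suc e) u * G (suc i) u))
    dominated-upper l i i≤e ev with ℕ.m≤n⇒m<n∨m≡n i≤e
    -- Parity pays off here: l + 2e even forces l even, so the power of X is nonnegative.
    dominated-upper l i i≤e ev | inj₂ refl = dominated-lloyd² l (Even-cancel l e ev)
    dominated-upper zero i i≤e ev | inj₁ _ = dominated-cong
      (λ u → trans (ℤ.*-comm (G (suc i) u) (G (suc e) u)) (sym (ℤ.*-identityˡ _))) (dominated-GG i≤e ℕ.≤-refl)
    dominated-upper (suc l) zero i≤e ev | inj₁ i<e = dominated-X* l (G (suc e)) 0 z≤n
      (dominated-upper l 1 i<e (parity-up l e 0 ev)) (dominated-zero l (G (suc e)))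
    dominated-upper (suc l) (suc i) i≤e ev | inj₁ i<e = dominated-X* l (G (suc e)) (suc i) (ℕ.≤-trans i≤e e≤n)
      (dominated-upper l (2 ℕ.+ i) i<e (parity-up l e (suc i) ev))
      (dominated-upper l i (ℕ.<⇒≤ i≤e) (parity-down l e i ev))

    -- `G 1` is 1, so this concerns X^l times a single eigenvalue. When the index climbs to e, the
    -- factor `G 1` is reread as the lowest member of the family in `dominated-upper`.
    dominated-lower : ∀ l i → i ℕ.≤ e → Even (l ℕ.+ i) → Dominated (λ u → X u ^ l * (G 1 u * G (suc i) u))
    dominated-lower l i i≤e ev with ℕ.m≤n⇒m<n∨m≡n i≤e
    dominated-lower l i i≤e ev | inj₂ refl = dominated-cong
      (λ u → cong (X u ^ l *_) (ℤ.*-comm (G (suc e) u) (G 1 u)))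
      (dominated-upper l 0 z≤n (subst (λ k → Even (l ℕ.+ k)) (sym (ℕ.+-identityʳ e)) ev))
    dominated-lower zero i i≤e ev | inj₁ _ = dominated-cong (λ u → sym (ℤ.*-identityˡ _)) (dominated-GG z≤n i≤e)
    dominated-lower (suc l) zero i≤e ev | inj₁ i<e = dominated-X* l (G 1) 0 z≤n
      (dominated-lower l 1 i<e (parity-up l 0 0 ev)) (dominated-zero l (G 1))
    dominated-lower (suc l) (suc i) i≤e ev | inj₁ i<e = dominated-X* l (G 1) (suc i) (ℕ.≤-trans i≤e e≤n)
      (dominated-lower l (2 ℕ.+ i) i<e (parity-up l 0 (suc i) ev))
      (dominated-lower l i (ℕ.<⇒≤ i≤e) (parity-down l 0 i ev))

    dominated-even-power : ∀ l → Even l → Dominated (λ u → X u ^ l)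
    dominated-even-power l ev = dominated-cong
      (λ u → trans (cong (λ g → X u ^ l * (g * g)) (G-1 u)) (ℤ.*-identityʳ _))
      (dominated-lower l 0 z≤n (subst Even (sym (ℕ.+-identityʳ l)) ev))

-- Growth estimates and comparison of weighted sums over ℕ

module Comparisons where

  open WalshTransform
  open BallSpectrum
  open import Data.Bool using (true; false)
  open import Data.Product using (∃; ∃₂; _×_; _,_)
  open import Data.Nat using (ℕ; zero; suc; pred; s≤s; z≤n; _+_; _*_; _^_; _≤_; _<_; _≤?_)
  open import Data.Nat.Properties
  open import Data.Nat.Tactic.RingSolver using (solve-∀)
  open import Algebra.Properties.CommutativeSemigroup *-commutativeSemigroup using (x∙yz≈y∙xz)
  import Data.Integer as ℤ
  import Data.Integer.Properties as ℤ
  open import Data.Vec using ([]; _∷_)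
  open import Relation.Nullary using (¬_; yes; no; contradiction)
  open import Relation.Binary.PropositionalEquality

  ∑ℕ : ∀ {n} → (Word n → ℕ) → ℕ
  ∑ℕ {zero}  f = f []
  ∑ℕ {suc n} f = ∑ℕ λ w → f (false ∷ w) + f (true ∷ w)

  ∑ℕ-cong : ∀ {n} {f g : Word n → ℕ} → (∀ x → f x ≡ g x) → ∑ℕ f ≡ ∑ℕ g
  ∑ℕ-cong {zero}  p = p []
  ∑ℕ-cong {suc n} p = ∑ℕ-cong λ w → cong₂ _+_ (p (false ∷ w)) (p (true ∷ w))

  ∑ℕ-mono : ∀ {n} {f g : Word n → ℕ} → (∀ x → f x ≤ g x) → ∑ℕ f ≤ ∑ℕ g
  ∑ℕ-mono {zero}  p = p []
  ∑ℕ-mono {suc n} p = ∑ℕ-mono λ w → +-mono-≤ (p (false ∷ w)) (p (true ∷ w))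

  ∑-pos : ∀ {n} (f : Word n → ℕ) → ∑ (λ x → ℤ.+ f x) ≡ ℤ.+ ∑ℕ f
  ∑-pos {zero}  f = refl
  ∑-pos {suc n} f = ∑-pos (λ w → f (false ∷ w) + f (true ∷ w))

  ∑ℕ-+ : ∀ {n} (f g : Word n → ℕ) → ∑ℕ (λ x → f x + g x) ≡ ∑ℕ f + ∑ℕ g
  ∑ℕ-+ f g = ℤ.+-injective (trans (sym (∑-pos (λ x → f x + g x)))
    (trans (∑-+ (λ x → ℤ.+ f x) (λ x → ℤ.+ g x)) (cong₂ ℤ._+_ (∑-pos f) (∑-pos g))))

  ∑ℕ-* : ∀ {n} c (f : Word n → ℕ) → ∑ℕ (λ x → c * f x) ≡ c * ∑ℕ f
  ∑ℕ-* {zero}  c f = refl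
  ∑ℕ-* {suc n} c f = trans
    (∑ℕ-cong λ w → sym (*-distribˡ-+ c (f (false ∷ w)) (f (true ∷ w))))
    (∑ℕ-* c (λ w → f (false ∷ w) + f (true ∷ w)))

  -- Bernoulli's inequality (1 + 1/q)^k ≥ 1 + k/q, multiplied by q^(k+1).
  bernoulli : ∀ q k → q ^ k * (q + k) ≤ q * suc q ^ k
  bernoulli q zero    = ≤-reflexive (lemma q)
    where
    lemma : ∀ q → 1 * (q + 0) ≡ q * 1
    lemma = solve-∀
  bernoulli q (suc k) = begin
    q * q ^ k * (q + suc k)                ≡⟨ expand q k (q ^ k) ⟩
    q * (q ^ k * (q + k)) + q * q ^ k      ≤⟨ +-mono-≤ (*-monoʳ-≤ q (bernoulli q k)) (*-monoʳ-≤ q (^-monoˡ-≤ k (n≤1+n q))) ⟩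
    q * (q * suc q ^ k) + q * suc q ^ k    ≡⟨ collect q (suc q ^ k) ⟩
    q * (suc q * suc q ^ k)                ∎
    where
    open ≤-Reasoning
    expand : ∀ q k p → q * p * (q + suc k) ≡ q * (p * (q + k)) + q * p
    expand = solve-∀
    collect : ∀ q p → q * (q * p) + q * p ≡ q * (suc q * p)
    collect = solve-∀

  powers-separate : ∀ q c → ∃ λ k → ¬ suc q ^ k ≤ q ^ k * c
  powers-separate zero    c = 1 , λ ()
  powers-separate (suc q) c = k , λ le → <⇒≱ (m<n+m k (s≤s {n = q} z≤n))
    (≤-trans (*-cancelˡ-≤ (suc q ^ k) {{m^n≢0 (suc q) k}} (begin
      suc q ^ k * (suc q + k)        ≤⟨ bernoulli (suc q) k ⟩
      suc q * suc (suc q) ^ k        ≤⟨ *-monoʳ-≤ (suc q) le ⟩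
      suc q * (suc q ^ k * c)        ≡⟨ x∙yz≈y∙xz (suc q) (suc q ^ k) c ⟩
      suc q ^ k * (suc q * c)        ∎)) (n≤1+n (suc q * c)))
    where
    open ≤-Reasoning
    -- Just large enough that cancelling the k-th power of `suc q` leaves `suc q + k ≤ suc q * c`,
    -- which is absurd.
    k = suc (suc q * c)

  -- Bernoulli's inequality (1 - y/z)ᵐ ≥ 1 - m y/z with z = x + y, cleared of denominators.
  bernoulli-shift : ∀ m x y → (x + y) ^ m * (x + y) ≤ (x + y) * x ^ m + m * y * (x + y) ^ m
  bernoulli-shift zero    x y = ≤-reflexive (lemma (x + y))
    where
    lemma : ∀ z → 1 * z ≡ z * 1 + 0
    lemma = solve-∀
  bernoulli-shift (suc m) x y = begin
    z * z ^ m * z                                     ≡⟨ *-assoc z (z ^ m) z ⟩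
    z * (z ^ m * z)                                   ≤⟨ *-monoʳ-≤ z (bernoulli-shift m x y) ⟩
    z * (z * x ^ m + m * y * z ^ m)                   ≡⟨ expand x y m (x ^ m) (z ^ m) ⟩
    z * (x * x ^ m) + (y * (z * x ^ m) + m * y * (z * z ^ m))
      ≤⟨ +-monoʳ-≤ (z * (x * x ^ m)) (+-monoˡ-≤ (m * y * (z * z ^ m))
           (*-monoʳ-≤ y (*-monoʳ-≤ z (^-monoˡ-≤ m (m≤m+n x y))))) ⟩
    z * (x * x ^ m) + (y * (z * z ^ m) + m * y * (z * z ^ m))
      ≡⟨ cong (z * (x * x ^ m) +_) (collect y m (z * z ^ m)) ⟩
    z * (x * x ^ m) + suc m * y * (z * z ^ m)         ∎
    where
    open ≤-Reasoning
    z = x + y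
    expand : ∀ x y m p q → (x + y) * ((x + y) * p + m * y * q) ≡
      (x + y) * (x * p) + (y * ((x + y) * p) + m * y * ((x + y) * q))
    expand = solve-∀
    collect : ∀ y m p → y * p + m * y * p ≡ suc m * y * p
    collect = solve-∀

  -- The ratio of the two powers tends to 1. For naturals a failure means s ≥ s′ + 1, which a single
  -- large l already refutes.
  ≤-limit : ∀ m s s′ → (∀ l → (2 * l) ^ m * s ≤ (2 * l + 2 * m) ^ m * s′) → s ≤ s′
  ≤-limit m s s′ hyp with s ≤? s′
  ... | yes p = p
  ... | no ¬p = contradiction (*-cancelˡ-≤ (z ^ m) {{m^n≢0 z m}} key) (<⇒≱ large)
    where
    y = 2 * m
    -- The Bernoulli error term times s′ + 1; the refutation needs only z > b, which `l = suc b`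
    -- provides.
    b = m * y * suc s′
    l = suc b
    x = 2 * l
    z = x + y
    large : b < z
    large = ≤-trans (m≤m+n l (l + 0)) (m≤m+n x y)
    open ≤-Reasoning
    expand : ∀ p z s → p * z * suc s ≡ z * p * s + p * z
    expand = solve-∀
    regroup : ∀ z p c q s → (z * p + c * q) * s ≡ z * (p * s) + q * (c * s)
    regroup = solve-∀
    key : z ^ m * z ≤ z ^ m * b
    key = +-cancelˡ-≤ (z * z ^ m * s′) _ _ (begin
      z * z ^ m * s′ + z ^ m * z                        ≡⟨ sym (expand (z ^ m) z s′) ⟩
      z ^ m * z * suc s′                                ≤⟨ *-monoˡ-≤ (suc s′) (bernoulli-shift m x y) ⟩
      (z * x ^ m + m * y * z ^ m) * suc s′              ≡⟨ regroup z (x ^ m) (m * y) (z ^ m) (suc s′) ⟩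
      z * (x ^ m * suc s′) + z ^ m * b                  ≤⟨ +-monoˡ-≤ (z ^ m * b) (*-monoʳ-≤ z
                                                            (≤-trans (*-monoʳ-≤ (x ^ m) (≰⇒> ¬p)) (hyp l))) ⟩
      z * (z ^ m * s′) + z ^ m * b                      ≡⟨ cong (_+ z ^ m * b) (sym (*-assoc z (z ^ m) s′)) ⟩
      z * z ^ m * s′ + z ^ m * b                        ∎)

  -- `φ` stands for the reciprocal of `d`, scaled by Ω to be a natural number. Ω is the product of
  -- all values of `d`.
  common-multiple : ∀ {n} (d : Word n → ℕ) → (∀ u → 1 ≤ d u) →
    ∃₂ λ (Ω : ℕ) (φ : Word n → ℕ) → 1 ≤ Ω × (∀ u → φ u * d u ≡ Ω)
  common-multiple {zero}  d d≥1 = d [] , (λ _ → 1) , d≥1 [] , λ { [] → *-identityˡ (d []) }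
  common-multiple {suc n} d d≥1
    with common-multiple (λ u → d (false ∷ u)) (λ u → d≥1 (false ∷ u))
       | common-multiple (λ u → d (true ∷ u)) (λ u → d≥1 (true ∷ u))
  ... | Ω₀ , φ₀ , Ω₀≥1 , eq₀ | Ω₁ , φ₁ , Ω₁≥1 , eq₁ =
    Ω₀ * Ω₁ , φ , *-mono-≤ Ω₀≥1 Ω₁≥1 , eq
    where
    φ : Word (suc n) → ℕ
    φ (false ∷ u) = φ₀ u * Ω₁
    φ (true  ∷ u) = φ₁ u * Ω₀
    swap : ∀ a b c → a * b * c ≡ a * c * b
    swap = solve-∀
    eq : ∀ u → φ u * d u ≡ Ω₀ * Ω₁
    eq (false ∷ u) = trans (swap (φ₀ u) Ω₁ (d (false ∷ u))) (cong (_* Ω₁) (eq₀ u))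
    eq (true  ∷ u) = trans (swap (φ₁ u) Ω₀ (d (true ∷ u))) (trans (cong (_* Ω₀) (eq₁ u)) (*-comm Ω₁ Ω₀))

  -- The quotient by `γ l` is a product of i odd numbers, from 2l + 1 up to 2(l + i) - 1. Together
  -- with `γ-lower` this shows it to be asymptotically (2l)^i.
  γ-upper : ∀ l m i → i ≤ m → γ (i + l) ≤ γ l * (2 * l + 2 * m) ^ i
  γ-upper l m zero    _   = ≤-reflexive (sym (*-identityʳ (γ l)))
  γ-upper l m (suc i) i<m = begin
    suc (2 * (i + l)) * γ (i + l)           ≤⟨ *-mono-≤ bound (γ-upper l m i (<⇒≤ i<m)) ⟩
    z * (γ l * z ^ i)                       ≡⟨ x∙yz≈y∙xz z (γ l) (z ^ i) ⟩
    γ l * (z * z ^ i)                       ∎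
    where
    open ≤-Reasoning
    z = 2 * l + 2 * m
    expand : ∀ i l → suc (suc (2 * (i + l))) ≡ 2 * l + 2 * suc i
    expand = solve-∀
    bound : suc (2 * (i + l)) ≤ z
    bound = ≤-trans (n≤1+n _) (≤-trans (≤-reflexive (expand i l)) (+-monoʳ-≤ (2 * l) (*-monoʳ-≤ 2 i<m)))

  γ-lower : ∀ l i → γ l * (2 * l) ^ i ≤ γ (i + l)
  γ-lower l zero    = ≤-reflexive (*-identityʳ (γ l))
  γ-lower l (suc i) = begin
    γ l * (2 * l * (2 * l) ^ i)             ≡⟨ x∙yz≈y∙xz (γ l) (2 * l) ((2 * l) ^ i) ⟩
    2 * l * (γ l * (2 * l) ^ i)             ≤⟨ *-mono-≤ (≤-trans (*-monoʳ-≤ 2 (m≤n+m l i)) (n≤1+n _)) (γ-lower l i) ⟩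
    suc (2 * (i + l)) * γ (i + l)           ∎
    where
    open ≤-Reasoning

  module Comparison {n} (a a′ t : Word n → ℕ) where

    record Below (φ : Word n → ℕ) : Set where
      constructor below
      field isBelow : ∑ℕ (λ u → φ u * a u) ≤ ∑ℕ (λ u → φ u * a′ u)
    open Below public

    below-cong : ∀ {φ ψ} → (∀ u → φ u ≡ ψ u) → Below φ → Below ψ
    below-cong eq (below p) = below
      (subst₂ _≤_ (∑ℕ-cong λ u → cong (_* a u) (eq u)) (∑ℕ-cong λ u → cong (_* a′ u) (eq u)) p)

    below-* : ∀ c {φ} → Below φ → Below (λ u → c * φ u)
    below-* c {φ} (below p) = below (subst₂ _≤_ (scale a) (scale a′) (*-monoʳ-≤ c p))
      where
      scale : ∀ b → c * ∑ℕ (λ u → φ u * b u) ≡ ∑ℕ (λ u → c * φ u * b u)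
      scale b = trans (sym (∑ℕ-* c (λ u → φ u * b u))) (∑ℕ-cong λ u → sym (*-assoc c (φ u) (b u)))

    -- Dividing at exponent r uses the hypothesis at every exponent from r on, so only the whole
    -- family can be divided repeatedly.
    AllBelow : (Word n → ℕ) → Set
    AllBelow φ = ∀ r → Below (λ u → t u ^ r * φ u)

    -- With A = q + 1 = d + t on the support, a violation v at exponent r propagates to Aᵏ v at
    -- exponent r + k, while the sums grow at most like qᵏ.
    module _ (q : ℕ) (d : Word n → ℕ) (d≥1 : ∀ u → 1 ≤ d u)
      (eq  : ∀ u → (d u + t u) * a u ≡ suc q * a u)
      (eq′ : ∀ u → (d u + t u) * a′ u ≡ suc q * a′ u) where

      below-divide : ∀ φ → AllBelow (λ u → φ u * d u) → AllBelow φ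
      below-divide φ hyp r with ∑ℕ (λ u → t u ^ r * φ u * a u) ≤? ∑ℕ (λ u → t u ^ r * φ u * a′ u)
      ... | yes p = below p
      -- The sum at exponent r starts the growth bound; k is where (q + 1)^k overtakes q^k times it.
      ... | no ¬p with powers-separate q (∑ℕ (λ u → t u ^ r * φ u * a u))
      ... | k , ¬le = contradiction
        (≤-trans (m+n≤o⇒n≤o (s a′ (k + r)) (propagate k)) (growth k)) ¬le
        where
        open ≤-Reasoning
        s : (Word n → ℕ) → ℕ → ℕ
        s b r = ∑ℕ (λ u → t u ^ r * φ u * b u)

        T : (Word n → ℕ) → ℕ → ℕ
        T b r = ∑ℕ (λ u → t u ^ r * (φ u * d u) * b u)

        split : ∀ b → (∀ u → (d u + t u) * b u ≡ suc q * b u) → ∀ r → suc q * s b r ≡ T b r + s b (suc r)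
        split b e r = trans (sym (∑ℕ-* (suc q) (λ u → t u ^ r * φ u * b u))) (trans
          (∑ℕ-cong λ u → trans (x∙yz≈y∙xz (suc q) (t u ^ r * φ u) (b u)) (trans
            (cong (t u ^ r * φ u *_) (sym (e u))) (expand (t u ^ r) (φ u) (d u) (t u) (b u))))
          (∑ℕ-+ (λ u → t u ^ r * (φ u * d u) * b u) (λ u → t u ^ suc r * φ u * b u)))
          where
          expand : ∀ p f d t b → p * f * ((d + t) * b) ≡ p * (f * d) * b + t * p * f * b
          expand = solve-∀

        -- By `split`, q + 1 times a sum is the part with `d`, ordered correctly by hypothesis, plus
        -- the next sum; the latter must carry the entire multiplied violation.
        step : ∀ r v → s a′ r + v ≤ s a r → s a′ (suc r) + suc q * v ≤ s a (suc r)
        step r v le = +-cancelˡ-≤ (T a r) _ _ (begin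
          T a r + (s a′ (suc r) + suc q * v)     ≤⟨ +-monoˡ-≤ _ (isBelow (hyp r)) ⟩
          T a′ r + (s a′ (suc r) + suc q * v)    ≡⟨ sym (+-assoc (T a′ r) (s a′ (suc r)) (suc q * v)) ⟩
          T a′ r + s a′ (suc r) + suc q * v      ≡⟨ cong (_+ suc q * v) (sym (split a′ eq′ r)) ⟩
          suc q * s a′ r + suc q * v             ≡⟨ sym (*-distribˡ-+ (suc q) (s a′ r) v) ⟩
          suc q * (s a′ r + v)                   ≤⟨ *-monoʳ-≤ (suc q) le ⟩
          suc q * s a r                          ≡⟨ split a eq r ⟩
          T a r + s a (suc r)                    ∎)

        propagate : ∀ k → s a′ (k + r) + suc q ^ k ≤ s a (k + r)
        -- Integrality makes the initial violation at least 1.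
        propagate zero    = ≤-trans (≤-reflexive (+-comm (s a′ r) 1)) (≰⇒> ¬p)
        propagate (suc k) = step (k + r) (suc q ^ k) (propagate k)

        t*a≤q*a : ∀ u → t u * a u ≤ q * a u
        t*a≤q*a u = +-cancelˡ-≤ (a u) _ _ (begin
          a u + t u * a u           ≤⟨ +-monoˡ-≤ (t u * a u) (≤-trans (≤-reflexive (sym (*-identityˡ (a u)))) (*-monoˡ-≤ (a u) (d≥1 u))) ⟩
          d u * a u + t u * a u     ≡⟨ sym (*-distribʳ-+ (a u) (d u) (t u)) ⟩
          (d u + t u) * a u         ≡⟨ eq u ⟩
          a u + q * a u             ∎)

        growth-step : ∀ r → s a (suc r) ≤ q * s a r
        growth-step r = ≤-trans (∑ℕ-mono λ u → begin
            t u * t u ^ r * φ u * a u     ≡⟨ pull (t u) (t u ^ r) (φ u) (a u) ⟩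
            t u ^ r * φ u * (t u * a u)   ≤⟨ *-monoʳ-≤ (t u ^ r * φ u) (t*a≤q*a u) ⟩
            t u ^ r * φ u * (q * a u)     ≡⟨ x∙yz≈y∙xz (t u ^ r * φ u) q (a u) ⟩
            q * (t u ^ r * φ u * a u)     ∎)
          (≤-reflexive (∑ℕ-* q (λ u → t u ^ r * φ u * a u)))
          where
          pull : ∀ t p f a → t * p * f * a ≡ p * f * (t * a)
          pull = solve-∀

        growth : ∀ k → s a (k + r) ≤ q ^ k * s a r
        growth zero    = ≤-reflexive (sym (*-identityˡ (s a r)))
        growth (suc k) = ≤-trans (growth-step (k + r)) (≤-trans (*-monoʳ-≤ q (growth k))
          (≤-reflexive (sym (*-assoc q (q ^ k) (s a r)))))

  -- For u ≠ 0 this is (n + 2l)² − X², written as (n + 2l + X) (n + 2l − X).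
  factor : ∀ {n} → ℕ → Word n → ℕ
  factor l u = suc (2 * (l + falses u)) * suc (2 * (l + pred (trues u)))

  factors : ∀ {n} → ℕ → Word n → ℕ
  factors zero    u = 1
  factors (suc l) u = factor l u * factors l u

  factors≥1 : ∀ {n} l (u : Word n) → 1 ≤ factors l u
  factors≥1 zero    u = s≤s z≤n
  factors≥1 (suc l) u = *-mono-≤ {1} {factor l u} (s≤s z≤n) (factors≥1 l u)

  -- (2i - 1)!! (2j - 1)!! with j one less than the number of ones. At `𝟎` the `pred` gives a
  -- default value, multiplied later by a vanishing power.
  weight : ∀ {n} → Word n → ℕ
  weight u = γ (falses u) * γ (pred (trues u))

  weight*factors : ∀ {n} l (u : Word n) → weight u * factors l u ≡ γ (l + falses u) * γ (l + pred (trues u))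
  weight*factors zero    u = *-identityʳ (weight u)
  weight*factors (suc l) u = trans (x∙yz≈y∙xz (weight u) (factor l u) (factors l u))
    (trans (cong (factor l u *_) (weight*factors l u))
           (regroup (suc (2 * (l + falses u))) (suc (2 * (l + pred (trues u)))) (γ (l + falses u)) (γ (l + pred (trues u)))))
    where
    regroup : ∀ a b c d → a * b * (c * d) ≡ a * c * (b * d)
    regroup = solve-∀

  X² : ∀ {n} → Word n → ℕ
  X² u = ℤ.∣ X u ∣ * ℤ.∣ X u ∣

-- From even moments to the double-factorial weight

module WeightComparison where

  open WalshTransform
  open BallSpectrum
  open EvenMoments using (square-∣∣)
  open Comparisons
  open import Data.Product using (_,_)
  open import Data.Nat using (ℕ; zero; suc; pred; s≤s; z≤n; _+_; _*_; _^_; _≤_; _∸_; >-nonZero)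
  open import Data.Nat.Properties
  open import Data.Nat.Tactic.RingSolver using (solve-∀)
  open import Algebra.Properties.CommutativeSemigroup *-commutativeSemigroup using (x∙yz≈y∙xz)
  open import Data.Integer as ℤ using (1ℤ)
  import Data.Integer.Properties as ℤ
  import Data.Integer.Tactic.RingSolver as ℤ-Solver
  open import Relation.Binary.PropositionalEquality

  factor+X² : ∀ {n} l (u : Word n) {j} → trues u ≡ suc j → factor l u + X² u ≡ (n + 2 * l) * (n + 2 * l)
  factor+X² {n} l u {j} nz rewrite nz = ℤ.+-injective (begin
    ℤ.+ (suc (2 * (l + i)) * suc (2 * (l + j))) ℤ.+ ℤ.+ X² u
      ≡⟨ cong₂ ℤ._+_ (trans (ℤ.pos-* (suc (2 * (l + i))) (suc (2 * (l + j)))) (cong₂ ℤ._*_ (odd i) (odd j)))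
                     (trans (sym (square-∣∣ (X u))) (cong (λ x → x ℤ.* x) (X-nonzero u nz))) ⟩
    (1ℤ ℤ.+ ℤ.+ 2 ℤ.* (l⁺ ℤ.+ i⁺)) ℤ.* (1ℤ ℤ.+ ℤ.+ 2 ℤ.* (l⁺ ℤ.+ j⁺)) ℤ.+ (i⁺ ℤ.- j⁺) ℤ.* (i⁺ ℤ.- j⁺)
      ≡⟨ ring l⁺ i⁺ j⁺ ⟩
    (1ℤ ℤ.+ (i⁺ ℤ.+ j⁺) ℤ.+ ℤ.+ 2 ℤ.* l⁺) ℤ.* (1ℤ ℤ.+ (i⁺ ℤ.+ j⁺) ℤ.+ ℤ.+ 2 ℤ.* l⁺)
      ≡⟨ cong (λ x → (1ℤ ℤ.+ (i⁺ ℤ.+ j⁺) ℤ.+ x) ℤ.* (1ℤ ℤ.+ (i⁺ ℤ.+ j⁺) ℤ.+ x)) (sym (ℤ.pos-* 2 l)) ⟩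
    ℤ.+ (suc (i + j) + 2 * l) ℤ.* ℤ.+ (suc (i + j) + 2 * l)
      ≡⟨ cong (λ k → ℤ.+ (k + 2 * l) ℤ.* ℤ.+ (k + 2 * l)) (sym (length-nonzero u nz)) ⟩
    ℤ.+ (n + 2 * l) ℤ.* ℤ.+ (n + 2 * l)
      ≡⟨ sym (ℤ.pos-* (n + 2 * l) (n + 2 * l)) ⟩
    ℤ.+ ((n + 2 * l) * (n + 2 * l)) ∎)
    where
    open ≡-Reasoning
    i = falses u
    i⁺ = ℤ.+ i
    j⁺ = ℤ.+ j
    l⁺ = ℤ.+ l
    odd : ∀ i → ℤ.+ suc (2 * (l + i)) ≡ 1ℤ ℤ.+ ℤ.+ 2 ℤ.* (l⁺ ℤ.+ ℤ.+ i)
    odd i = cong (ℤ._+_ 1ℤ) (ℤ.pos-* 2 (l + i))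
    ring : ∀ l⁺ i⁺ j⁺ → (1ℤ ℤ.+ ℤ.+ 2 ℤ.* (l⁺ ℤ.+ i⁺)) ℤ.* (1ℤ ℤ.+ ℤ.+ 2 ℤ.* (l⁺ ℤ.+ j⁺)) ℤ.+ (i⁺ ℤ.- j⁺) ℤ.* (i⁺ ℤ.- j⁺)
      ≡ (1ℤ ℤ.+ (i⁺ ℤ.+ j⁺) ℤ.+ ℤ.+ 2 ℤ.* l⁺) ℤ.* (1ℤ ℤ.+ (i⁺ ℤ.+ j⁺) ℤ.+ ℤ.+ 2 ℤ.* l⁺)
    ring = ℤ-Solver.solve-∀

  -- Identities involving `pred (trues u)` are established for u ≠ 0; multiplied by such a `b`, they
  -- hold for every u.
  NullAt𝟎 : ∀ {n} → (Word n → ℕ) → Set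
  NullAt𝟎 b = ∀ u → trues u ≡ 0 → b u ≡ 0

  module _ {n} {a a′ : Word n → ℕ} (null : NullAt𝟎 a) (null′ : NullAt𝟎 a′) where

    open Comparison a a′ X²

    private
      m = n ∸ 1

      on-support : ∀ {b : Word n → ℕ} → NullAt𝟎 b → (f g : Word n → ℕ) →
        (∀ u {j} → trues u ≡ suc j → f u ≡ g u) → ∀ u → f u * b u ≡ g u * b u
      on-support {b} nul f g eq u with trues u in nz
      ... | suc j = cong (_* b u) (eq u nz)
      ... | zero  = trans (trans (cong (f u *_) (nul u nz)) (*-zeroʳ (f u)))
                          (sym (trans (cong (g u *_) (nul u nz)) (*-zeroʳ (g u))))

      on-support-≤ : ∀ {b : Word n → ℕ} → NullAt𝟎 b → (f g : Word n → ℕ) →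
        (∀ u {j} → trues u ≡ suc j → f u ≤ g u) → ∀ u → f u * b u ≤ g u * b u
      on-support-≤ {b} nul f g le u with trues u in nz
      ... | suc j = *-monoˡ-≤ (b u) (le u nz)
      ... | zero  = ≤-trans (≤-reflexive (trans (cong (f u *_) (nul u nz)) (*-zeroʳ (f u)))) z≤n

      pole : ℕ → ℕ
      -- One less than the pole (n + 2l)² itself, since `below-divide` takes it in the form q + 1.
      pole l = pred ((n + 2 * l) * (n + 2 * l))

      pole-eq : ∀ l u {j} → trues u ≡ suc j → factor l u + X² u ≡ suc (pole l)
      pole-eq l u {j} nz = trans (factor+X² l u nz) (square-suc (length-nonzero u nz))
        where
        square-suc : ∀ {k} → n ≡ suc k → (n + 2 * l) * (n + 2 * l) ≡ suc (pole l)
        square-suc refl = refl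

    -- The factors are divided out one at a time; each is the pole minus X² on the support.
    allBelow-factors : ∀ l φ → AllBelow (λ u → φ u * factors l u) → AllBelow φ
    allBelow-factors zero    φ hyp r = below-cong (λ u → cong (X² u ^ r *_) (*-identityʳ (φ u))) (hyp r)
    allBelow-factors (suc l) φ hyp = below-divide (pole l) (factor l) (λ u → s≤s z≤n)
      (on-support null _ _ (pole-eq l)) (on-support null′ _ _ (pole-eq l)) φ
      (allBelow-factors l (λ u → φ u * factor l u)
        (λ r → below-cong (λ u → cong (X² u ^ r *_) (sym (*-assoc (φ u) (factor l u) (factors l u)))) (hyp r)))

    -- For each l the reciprocal of `factors l` is comparable by division, and `weight` is that
    -- reciprocal times `top`, which is constant up to a ratio tending to 1 as l grows.
    below-weight : (∀ r → Below (λ u → X² u ^ r)) → Below weight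
    below-weight moments = below (≤-limit m (S a) (S a′) bound)
      where
      S : (Word n → ℕ) → ℕ
      S b = ∑ℕ (λ u → weight u * b u)
      module _ (l : ℕ) where
        x = 2 * l
        z = 2 * l + 2 * m
        bound : x ^ m * S a ≤ z ^ m * S a′
        bound with common-multiple {n} (factors l) (factors≥1 l)
        ... | Ω , φ , Ω≥1 , cofactor = *-cancelˡ-≤ Ω {{>-nonZero Ω≥1}} (begin
            Ω * (x ^ m * S a)                     ≡⟨ x∙yz≈y∙xz Ω (x ^ m) (S a) ⟩
            x ^ m * (Ω * S a)                     ≤⟨ *-monoʳ-≤ (x ^ m) upper ⟩
            x ^ m * (γ l * γ l * z ^ m * F a)     ≤⟨ *-monoʳ-≤ (x ^ m) (*-monoʳ-≤ (γ l * γ l * z ^ m) (isBelow φ-below)) ⟩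
            x ^ m * (γ l * γ l * z ^ m * F a′)    ≡⟨ regroup (x ^ m) (γ l * γ l) (z ^ m) (F a′) ⟩
            z ^ m * (γ l * γ l * x ^ m * F a′)    ≤⟨ *-monoʳ-≤ (z ^ m) lower ⟩
            z ^ m * (Ω * S a′)                    ≡⟨ x∙yz≈y∙xz (z ^ m) Ω (S a′) ⟩
            Ω * (z ^ m * S a′)                    ∎)
          where
          open ≤-Reasoning
          regroup : ∀ p g q f → p * (g * q * f) ≡ q * (g * p * f)
          regroup = solve-∀
          F : (Word n → ℕ) → ℕ
          F b = ∑ℕ (λ u → φ u * b u)

          φ-below : Below φ
          φ-below = below-cong (λ u → *-identityˡ (φ u)) (allBelow-factors l φ
            -- Multiplying the cofactor back by `factors l` gives the constant Ω, so the hypothesis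
            -- to be divided is Ω times an even moment.
            (λ r → below-cong (λ u → trans (*-comm Ω (X² u ^ r)) (cong (X² u ^ r *_) (sym (cofactor u))))
                              (below-* Ω (moments r))) 0)

          top : Word n → ℕ
          top u = γ (falses u + l) * γ (pred (trues u) + l)

          Ω*S : ∀ b → Ω * S b ≡ ∑ℕ (λ u → top u * φ u * b u)
          Ω*S b = trans (sym (∑ℕ-* Ω (λ u → weight u * b u))) (∑ℕ-cong λ u → begin-equality
            Ω * (weight u * b u)                    ≡⟨ cong (_* (weight u * b u)) (sym (cofactor u)) ⟩
            φ u * factors l u * (weight u * b u)    ≡⟨ shuffle (φ u) (factors l u) (weight u) (b u) ⟩
            weight u * factors l u * φ u * b u      ≡⟨ cong (λ y → y * φ u * b u) (trans (weight*factors l u)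
                                                         (cong₂ (λ p q → γ p * γ q) (+-comm l _) (+-comm l _))) ⟩
            top u * φ u * b u                       ∎)
            where
            shuffle : ∀ p f w b → p * f * (w * b) ≡ w * f * p * b
            shuffle = solve-∀

          module _ (u : Word n) {j : ℕ} (nz : trues u ≡ suc j) where
            i = falses u
            i+j≡m : i + j ≡ m
            i+j≡m = sym (cong (_∸ 1) (length-nonzero u nz))
            top≡ : top u ≡ γ (i + l) * γ (j + l)
            top≡ = cong (λ k → γ (i + l) * γ (pred k + l)) nz
            merge : ∀ y → γ l * y ^ i * (γ l * y ^ j) ≡ γ l * γ l * y ^ m
            merge y = trans (shuffle (γ l) (y ^ i) (y ^ j)) (cong (γ l * γ l *_)
              (trans (sym (^-distribˡ-+-* y i j)) (cong (y ^_) i+j≡m)))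
              where
              shuffle : ∀ g p q → g * p * (g * q) ≡ g * g * (p * q)
              shuffle = solve-∀
            top-upper : top u ≤ γ l * γ l * z ^ m
            top-upper = ≤-trans (≤-reflexive top≡) (≤-trans
              (*-mono-≤ (γ-upper l m i (≤-trans (m≤m+n i j) (≤-reflexive i+j≡m)))
                        (γ-upper l m j (≤-trans (m≤n+m j i) (≤-reflexive i+j≡m))))
              (≤-reflexive (merge z)))
            top-lower : γ l * γ l * x ^ m ≤ top u
            top-lower = ≤-trans (≤-reflexive (sym (merge x)))
              (≤-trans (*-mono-≤ (γ-lower l i) (γ-lower l j)) (≤-reflexive (sym top≡)))

          upper : Ω * S a ≤ γ l * γ l * z ^ m * F a
          upper = begin
            Ω * S a                                         ≡⟨ Ω*S a ⟩
            ∑ℕ (λ u → top u * φ u * a u)                    ≤⟨ ∑ℕ-mono (on-support-≤ null _ _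
                                                                 (λ u nz → *-monoˡ-≤ (φ u) (top-upper u nz))) ⟩
            ∑ℕ (λ u → γ l * γ l * z ^ m * φ u * a u)        ≡⟨ ∑ℕ-cong (λ u → *-assoc (γ l * γ l * z ^ m) (φ u) (a u)) ⟩
            ∑ℕ (λ u → γ l * γ l * z ^ m * (φ u * a u))      ≡⟨ ∑ℕ-* (γ l * γ l * z ^ m) (λ u → φ u * a u) ⟩
            γ l * γ l * z ^ m * F a                         ∎

          lower : γ l * γ l * x ^ m * F a′ ≤ Ω * S a′
          lower = begin
            γ l * γ l * x ^ m * F a′                        ≡⟨ sym (∑ℕ-* (γ l * γ l * x ^ m) (λ u → φ u * a′ u)) ⟩
            ∑ℕ (λ u → γ l * γ l * x ^ m * (φ u * a′ u))     ≡⟨ ∑ℕ-cong (λ u → sym (*-assoc (γ l * γ l * x ^ m) (φ u) (a′ u))) ⟩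
            ∑ℕ (λ u → γ l * γ l * x ^ m * φ u * a′ u)       ≤⟨ ∑ℕ-mono (on-support-≤ null′ _ _
                                                                 (λ u nz → *-monoˡ-≤ (φ u) (top-lower u nz))) ⟩
            ∑ℕ (λ u → top u * φ u * a′ u)                   ≡⟨ sym (Ω*S a′) ⟩
            Ω * S a′                                        ∎

-- The scaled discrepancy as a weighted sum of spectral powers

module SpectralDiscrepancy where

  open WalshTransform
  open BallSpectrum
  open EvenMoments
  open Comparisons
  open WeightComparison
  open import Data.Product using (_,_)
  open import Data.Nat as ℕ using (ℕ; zero; suc; _!)
  import Data.Nat.Properties as ℕ
  open import Data.Integer using (ℤ; +_; 0ℤ; _+_; _*_; _^_; ∣_∣; _≤_; +≤+; +<+; Positive; positive; drop‿+≤+)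
  import Data.Integer.Properties as ℤ
  open import Data.Integer.Tactic.RingSolver using (solve-∀)
  open import Data.List using (List; length)
  open import Relation.Binary.PropositionalEquality

  scaledDiscrepancy : ∀ {n} → List (Word n) → ℤ
  scaledDiscrepancy {n} Z = sumTo (suc n) λ t → ∑ λ x → deviation Z t x * deviation Z t x

  discrepancy-spectrum : ∀ {n} (Z : List (Word n)) k →
    + (2 ℕ.^ n) * sumTo k (λ t → ∑ λ x → deviation Z t x * deviation Z t x) ≡ ∑ (λ u → spectrum k u * power Z u)
  discrepancy-spectrum {n} Z zero = trans (ℤ.*-zeroʳ (+ (2 ℕ.^ n)))
    (sym (trans (∑-const n 0ℤ) (ℤ.*-zeroʳ (+ (2 ℕ.^ n)))))
  discrepancy-spectrum {n} Z (suc k) = begin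
    P * (sumTo k D + D k)
      ≡⟨ ℤ.*-distribˡ-+ P (sumTo k D) (D k) ⟩
    P * sumTo k D + P * D k
      ≡⟨ cong₂ _+_ (discrepancy-spectrum Z k) (sym (∑-deviation² Z k k)) ⟩
    ∑ (λ u → spectrum k u * power Z u) + ∑ (λ u → G (suc k) u * G (suc k) u * power Z u)
      ≡⟨ sym (∑-+ (λ u → spectrum k u * power Z u) (λ u → G (suc k) u * G (suc k) u * power Z u)) ⟩
    ∑ (λ u → spectrum k u * power Z u + G (suc k) u * G (suc k) u * power Z u)
      ≡⟨ ∑-cong (λ u → sym (ℤ.*-distribʳ-+ (power Z u) (spectrum k u) (G (suc k) u * G (suc k) u))) ⟩
    ∑ (λ u → spectrum (suc k) u * power Z u) ∎
    where
    open ≡-Reasoning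
    P = + (2 ℕ.^ n)
    D : ℕ → ℤ
    D t = ∑ λ x → deviation Z t x * deviation Z t x

  powerℕ : ∀ {n} → List (Word n) → Word n → ℕ
  powerℕ Z u = ∣ wave Z u ∣ ℕ.* ∣ wave Z u ∣

  powerℕ-null : ∀ {n} (Z : List (Word n)) → NullAt𝟎 (powerℕ Z)
  powerℕ-null Z u eq = trans (cong (powerℕ Z) (trues-0 u eq)) (cong (λ w → ∣ w ∣ ℕ.* ∣ w ∣) (wave-𝟎 Z))

  ∑-power : ∀ {n} (Z : List (Word n)) (φ : Word n → ℕ) →
    ∑ (λ u → + φ u * power Z u) ≡ + ∑ℕ (λ u → φ u ℕ.* powerℕ Z u)
  ∑-power Z φ = trans
    (∑-cong λ u → trans (cong (+ φ u *_) (square-∣∣ (wave Z u))) (sym (ℤ.pos-* (φ u) (powerℕ Z u))))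
    (∑-pos (λ u → φ u ℕ.* powerℕ Z u))

  spectrum*power : ∀ {n} (Z : List (Word n)) u →
    + ((n ℕ.∸ 1) !) * (spectrum (suc n) u * power Z u) ≡ + (2 ℕ.^ (n ℕ.∸ 1)) * (+ weight u * power Z u)
  spectrum*power {n} Z u with trues u in nz
  ... | zero = trans (null (+ ((n ℕ.∸ 1) !)) (spectrum (suc n) u))
                     (sym (null (+ (2 ℕ.^ (n ℕ.∸ 1))) (+ (γ (falses u) ℕ.* γ 0))))
    where
    ring : ∀ p q → p * (q * 0ℤ) ≡ 0ℤ
    ring = solve-∀
    null : ∀ p q → p * (q * power Z u) ≡ 0ℤ
    null p q = trans
      (cong (λ w → p * (q * (w * w))) (trans (cong (wave Z) (trues-0 u nz)) (wave-𝟎 Z))) (ring p q)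
  ... | suc j = begin
    + ((n ℕ.∸ 1) !) * (spectrum (suc n) u * power Z u)
      ≡⟨ sym (ℤ.*-assoc (+ ((n ℕ.∸ 1) !)) (spectrum (suc n) u) (power Z u)) ⟩
    + ((n ℕ.∸ 1) !) * spectrum (suc n) u * power Z u
      ≡⟨ cong (_* power Z u) formula ⟩
    + (2 ℕ.^ (n ℕ.∸ 1)) * (+ γ (falses u) * + γ j) * power Z u
      ≡⟨ cong (λ w → + (2 ℕ.^ (n ℕ.∸ 1)) * w * power Z u) (sym (ℤ.pos-* (γ (falses u)) (γ j))) ⟩
    + (2 ℕ.^ (n ℕ.∸ 1)) * + (γ (falses u) ℕ.* γ j) * power Z u
      ≡⟨ ℤ.*-assoc (+ (2 ℕ.^ (n ℕ.∸ 1))) (+ (γ (falses u) ℕ.* γ j)) (power Z u) ⟩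
    + (2 ℕ.^ (n ℕ.∸ 1)) * (+ (γ (falses u) ℕ.* γ j) * power Z u) ∎
    where
    open ≡-Reasoning
    formula : + ((n ℕ.∸ 1) !) * spectrum (suc n) u ≡ + (2 ℕ.^ (n ℕ.∸ 1)) * (+ γ (falses u) * + γ j)
    formula = subst (λ m → + (m !) * spectrum (suc n) u ≡ + (2 ℕ.^ m) * (+ γ (falses u) * + γ j))
      (sym (cong (ℕ._∸ 1) (length-nonzero u nz))) (spectrum-formula u nz (suc n) (ℕ.n≤1+n n))

  -- The factor 2^n comes from Parseval; (n - 1)! and 2^(n-1) are the denominator and numerator of
  -- the constant in the spectral formula.
  discrepancy-weight : ∀ {n} (Z : List (Word n)) →
    + ((n ℕ.∸ 1) ! ℕ.* 2 ℕ.^ n) * scaledDiscrepancy Z ≡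
    + (2 ℕ.^ (n ℕ.∸ 1)) * + ∑ℕ (λ u → weight u ℕ.* powerℕ Z u)
  discrepancy-weight {n} Z = begin
    + (m ! ℕ.* 2 ℕ.^ n) * scaledDiscrepancy Z
      ≡⟨ cong (_* scaledDiscrepancy Z) (ℤ.pos-* (m !) (2 ℕ.^ n)) ⟩
    + (m !) * + (2 ℕ.^ n) * scaledDiscrepancy Z
      ≡⟨ ℤ.*-assoc (+ (m !)) (+ (2 ℕ.^ n)) (scaledDiscrepancy Z) ⟩
    + (m !) * (+ (2 ℕ.^ n) * scaledDiscrepancy Z)
      ≡⟨ cong (+ (m !) *_) (discrepancy-spectrum Z (suc n)) ⟩
    + (m !) * ∑ (λ u → spectrum (suc n) u * power Z u)
      ≡⟨ sym (∑-* (+ (m !)) (λ u → spectrum (suc n) u * power Z u)) ⟩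
    ∑ (λ u → + (m !) * (spectrum (suc n) u * power Z u))
      ≡⟨ ∑-cong (spectrum*power Z) ⟩
    ∑ (λ u → + (2 ℕ.^ m) * (+ weight u * power Z u))
      ≡⟨ ∑-* (+ (2 ℕ.^ m)) (λ u → + weight u * power Z u) ⟩
    + (2 ℕ.^ m) * ∑ (λ u → + weight u * power Z u)
      ≡⟨ cong (+ (2 ℕ.^ m) *_) (∑-power Z weight) ⟩
    + (2 ℕ.^ m) * + ∑ℕ (λ u → weight u ℕ.* powerℕ Z u) ∎
    where
    open ≡-Reasoning
    m = n ℕ.∸ 1

  X-even-power : ∀ {n} r (u : Word n) → X u ^ (r ℕ.+ r) ≡ + (X² u ℕ.^ r)
  X-even-power zero    u = refl
  X-even-power (suc r) u = begin
    X u * X u ^ (r ℕ.+ suc r)         ≡⟨ cong (λ k → X u * X u ^ k) (ℕ.+-suc r r) ⟩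
    X u * (X u * X u ^ (r ℕ.+ r))     ≡⟨ sym (ℤ.*-assoc (X u) (X u) (X u ^ (r ℕ.+ r))) ⟩
    X u * X u * X u ^ (r ℕ.+ r)       ≡⟨ cong₂ _*_ (square-∣∣ (X u)) (X-even-power r u) ⟩
    + X² u * + (X² u ℕ.^ r)           ≡⟨ sym (ℤ.pos-* (X² u) (X² u ℕ.^ r)) ⟩
    + (X² u ℕ.* X² u ℕ.^ r)           ∎
    where open ≡-Reasoning

  perfect-minimises : ∀ {n} (Z Z′ : List (Word n)) → IsPerfect Z → length Z′ ≡ length Z →
    scaledDiscrepancy Z ≤ scaledDiscrepancy Z′
  perfect-minimises {n} Z Z′ (e , perfect) same =
    ℤ.*-cancelˡ-≤-pos _ _ (+ (m ! ℕ.* 2 ℕ.^ n))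
      (subst₂ _≤_ (sym (discrepancy-weight Z)) (sym (discrepancy-weight Z′))
        (ℤ.*-monoˡ-≤-nonNeg (+ (2 ℕ.^ m)) (+≤+ (isBelow weights))))
    where
    m = n ℕ.∸ 1
    -- The given radius may exceed n, where the recurrence would have negative coefficients; the
    -- truncated radius has the same counts.
    open Moments Z Z′ (e ℕ.⊓ n) (ℕ.m⊓n≤n e n) (λ x → trans (countIn-⊓ e x Z) (perfect x)) same
    open Comparison (powerℕ Z) (powerℕ Z′) X²
    instance
      scale>0 : Positive (+ (m ! ℕ.* 2 ℕ.^ n))
      scale>0 = positive (+<+ (ℕ.*-mono-≤ (ℕ.1≤n! m) (ℕ.m^n>0 2 n)))

    moments : ∀ r → Below (λ u → X² u ℕ.^ r)
    moments r = below (drop‿+≤+ (subst₂ _≤_ (∑-power Z (λ u → X² u ℕ.^ r)) (∑-power Z′ (λ u → X² u ℕ.^ r))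
      (dominates (dominated-cong (X-even-power r) (dominated-even-power (r ℕ.+ r) (Even-double r))))))

    weights : Below weight
    weights = below-weight (powerℕ-null Z) (powerℕ-null Z′) moments

-- Clearing denominators in the rational discrepancy

module RationalDiscrepancy where

  open WalshTransform
  open BallSpectrum
  open EvenMoments
  open SpectralDiscrepancy
  open import Data.Bool using (true; false)
  open import Data.Product using (_,_)
  open import Data.Nat as ℕ using (ℕ; zero; suc; s≤s; z≤n)
  import Data.Nat.Properties as ℕ
  import Data.Nat.Coprimality as Coprime
  open import Data.Integer as ℤ using (ℤ; +_; 0ℤ; 1ℤ)
  import Data.Integer.Properties as ℤ
  import Data.Integer.Tactic.RingSolver as ℤ-Solver
  open import Data.Rational using (ℚ; mkℚ; 0ℚ; _+_; _*_; _-_; -_; _≤_; *≤*; Positive)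
  import Data.Rational.Properties as ℚ
  import Data.Rational.Unnormalised as ℚᵘ
  open ℚᵘ using (mkℚᵘ; *≡*)
  import Data.Rational.Unnormalised.Properties as ℚᵘ
  open import Data.Vec using ([]; _∷_)
  open import Data.List using (List; []; _∷_; length; map; concatMap; applyUpTo; _++_)
  open import Data.List.Properties using (map-upTo; applyUpTo-∷ʳ)
  open import Algebra.Bundles using (CommutativeMonoid)
  open import Algebra.Properties.CommutativeSemigroup
    (CommutativeMonoid.commutativeSemigroup ℚ.*-1-commutativeMonoid)
    using () renaming (interchange to *-interchange)
  open import Relation.Binary.PropositionalEquality

  fromℤ : ℤ → ℚ
  fromℤ i = mkℚ i 0 (Coprime.sym (Coprime.1-coprimeTo ℤ.∣ i ∣))

  fromℤ-+ : ∀ i j → fromℤ (i ℤ.+ j) ≡ fromℤ i + fromℤ j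
  fromℤ-+ i j = ℚ.toℚᵘ-injective (ℚᵘ.≃-trans (*≡* (lemma i j)) (ℚᵘ.≃-sym (ℚ.toℚᵘ-homo-+ (fromℤ i) (fromℤ j))))
    where
    lemma : ∀ i j → (i ℤ.+ j) ℤ.* 1ℤ ≡ (i ℤ.* 1ℤ ℤ.+ j ℤ.* 1ℤ) ℤ.* 1ℤ
    lemma = ℤ-Solver.solve-∀

  fromℤ-* : ∀ i j → fromℤ (i ℤ.* j) ≡ fromℤ i * fromℤ j
  fromℤ-* i j = ℚ.toℚᵘ-injective (ℚᵘ.≃-trans (*≡* refl) (ℚᵘ.≃-sym (ℚ.toℚᵘ-homo-* (fromℤ i) (fromℤ j))))

  fromℤ-neg : ∀ i → fromℤ (ℤ.- i) ≡ - fromℤ i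
  fromℤ-neg i = ℚ.toℚᵘ-injective (ℚᵘ.≃-trans (*≡* refl) (ℚᵘ.≃-sym (ℚ.toℚᵘ-homo‿- (fromℤ i))))

  fromℤ-mono : ∀ {i j} → i ℤ.≤ j → fromℤ i ≤ fromℤ j
  fromℤ-mono {i} {j} i≤j = *≤* (subst₂ ℤ._≤_ (sym (ℤ.*-identityʳ i)) (sym (ℤ.*-identityʳ j)) i≤j)

  frac*denominator : ∀ c m → 1 ℕ.≤ m → frac c m * fromℤ (+ m) ≡ fromℤ (+ c)
  frac*denominator c (suc m) _ = ℚ.toℚᵘ-injective (ℚᵘ.≃-trans (ℚ.toℚᵘ-homo-* (frac c (suc m)) (fromℤ (+ suc m)))
    (ℚᵘ.≃-trans (ℚᵘ.*-congʳ {mkℚᵘ (+ suc m) 0} (ℚ.toℚᵘ-fromℚᵘ (mkℚᵘ (+ c) m))) (*≡* lemma)))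
    where
    lemma : + c ℤ.* + suc m ℤ.* 1ℤ ≡ + c ℤ.* + (suc m ℕ.* 1)
    lemma = trans (ℤ.*-identityʳ _) (cong (λ k → + c ℤ.* + k) (sym (ℕ.*-identityʳ (suc m))))

  countIn-concatMap : ∀ {n} b (x : Word n) ws →
    countIn (b ∷ x) 0 (concatMap (λ w → (false ∷ w) ∷ (true ∷ w) ∷ []) ws) ≡ countIn x 0 ws
  countIn-concatMap b x [] = refl
  countIn-concatMap b x (w ∷ ws) = begin
    countIn (b ∷ x) 0 ((false ∷ w) ∷ (true ∷ w) ∷ rest)
      ≡⟨ countIn-∷ (b ∷ x) 0 (false ∷ w) ((true ∷ w) ∷ rest) ⟩
    within 0 (b ∷ x) (false ∷ w) ℕ.+ countIn (b ∷ x) 0 ((true ∷ w) ∷ rest)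
      ≡⟨ cong (within 0 (b ∷ x) (false ∷ w) ℕ.+_) (countIn-∷ (b ∷ x) 0 (true ∷ w) rest) ⟩
    within 0 (b ∷ x) (false ∷ w) ℕ.+ (within 0 (b ∷ x) (true ∷ w) ℕ.+ countIn (b ∷ x) 0 rest)
      ≡⟨ sym (ℕ.+-assoc (within 0 (b ∷ x) (false ∷ w)) (within 0 (b ∷ x) (true ∷ w)) _) ⟩
    within 0 (b ∷ x) (false ∷ w) ℕ.+ within 0 (b ∷ x) (true ∷ w) ℕ.+ countIn (b ∷ x) 0 rest
      ≡⟨ cong₂ ℕ._+_ (one b) (countIn-concatMap b x ws) ⟩
    within 0 x w ℕ.+ countIn x 0 ws
      ≡⟨ sym (countIn-∷ x 0 w ws) ⟩
    countIn x 0 (w ∷ ws) ∎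
    where
    open ≡-Reasoning
    rest = concatMap (λ w → (false ∷ w) ∷ (true ∷ w) ∷ []) ws
    one : ∀ b → within 0 (b ∷ x) (false ∷ w) ℕ.+ within 0 (b ∷ x) (true ∷ w) ≡ within 0 x w
    one false = ℕ.+-identityʳ _
    one true  = refl

  mult-allWords : ∀ {n} (x : Word n) → mult (allWords n) x ≡ 1ℤ
  mult-allWords []      = refl
  mult-allWords {suc n} (b ∷ x) = trans (cong +_ (countIn-concatMap b x (allWords n))) (mult-allWords x)

  -- The list of all words is a code with constant multiplicity 1, so its ball counts are the
  -- eigenvalue at the trivial character.
  ballSize-volume : ∀ {n} (x : Word n) t → + ballSize x t ≡ volume n t
  ballSize-volume {n} x t = begin
    + countIn x t (allWords n)                      ≡⟨ sym (ball-mult t (allWords n) x) ⟩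
    ball (suc t) (mult (allWords n)) x              ≡⟨ ball-cong (suc t) mult-allWords x ⟩
    -- The constant 1 in the affine shape that `ball-affine` expects.
    ball (suc t) (λ _ → 0ℤ ℤ.* 0ℤ ℤ.+ 1ℤ) x         ≡⟨ ball-affine (suc t) 0ℤ 1ℤ (λ _ → 0ℤ) x ⟩
    0ℤ ℤ.* ball (suc t) (λ _ → 0ℤ) x ℤ.+ 1ℤ ℤ.* volume n t
                                                    ≡⟨ lemma (ball (suc t) (λ _ → 0ℤ) x) (volume n t) ⟩
    volume n t                                      ∎
    where
    open ≡-Reasoning
    lemma : ∀ a v → 0ℤ ℤ.* a ℤ.+ 1ℤ ℤ.* v ≡ v
    lemma = ℤ-Solver.solve-∀

  sumℚ-concatMap : ∀ {n} (f : Word (suc n) → ℚ) ws →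
    sumℚ (map f (concatMap (λ w → (false ∷ w) ∷ (true ∷ w) ∷ []) ws)) ≡
    sumℚ (map (λ w → f (false ∷ w) + f (true ∷ w)) ws)
  sumℚ-concatMap f []       = refl
  sumℚ-concatMap f (w ∷ ws) = trans
    (cong (λ s → f (false ∷ w) + (f (true ∷ w) + s)) (sumℚ-concatMap f ws))
    (sym (ℚ.+-assoc (f (false ∷ w)) (f (true ∷ w)) _))

  sumℚ-allWords : ∀ {n} K (f : Word n → ℚ) (g : Word n → ℤ) → (∀ x → f x * K ≡ fromℤ (g x)) →
    sumℚ (map f (allWords n)) * K ≡ fromℤ (∑ g)
  sumℚ-allWords {zero}  K f g eq = trans (cong (_* K) (ℚ.+-identityʳ (f []))) (eq [])
  sumℚ-allWords {suc n} K f g eq = trans (cong (_* K) (sumℚ-concatMap f (allWords n)))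
    (sumℚ-allWords K _ _ λ w → trans (ℚ.*-distribʳ-+ K (f (false ∷ w)) (f (true ∷ w)))
      (trans (cong₂ _+_ (eq (false ∷ w)) (eq (true ∷ w))) (sym (fromℤ-+ (g (false ∷ w)) (g (true ∷ w))))))

  sumℚ-∷ʳ : ∀ xs y → sumℚ (xs ++ y ∷ []) ≡ sumℚ xs + y
  sumℚ-∷ʳ []       y = ℚ.+-comm y 0ℚ
  sumℚ-∷ʳ (x ∷ xs) y = trans (cong (_+_ x) (sumℚ-∷ʳ xs y)) (sym (ℚ.+-assoc x (sumℚ xs) y))

  sumℚ-applyUpTo : ∀ K (f : ℕ → ℚ) (g : ℕ → ℤ) → (∀ t → f t * K ≡ fromℤ (g t)) → ∀ k →
    sumℚ (applyUpTo f k) * K ≡ fromℤ (sumTo k g)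
  sumℚ-applyUpTo K f g eq zero    = ℚ.*-zeroˡ K
  sumℚ-applyUpTo K f g eq (suc k) = begin
    -- `sumTo` grows at its last term, so the list is split at its end.
    sumℚ (applyUpTo f (suc k)) * K         ≡⟨ cong (λ xs → sumℚ xs * K) (sym (applyUpTo-∷ʳ f k)) ⟩
    sumℚ (applyUpTo f k ++ f k ∷ []) * K   ≡⟨ cong (_* K) (sumℚ-∷ʳ (applyUpTo f k) (f k)) ⟩
    (sumℚ (applyUpTo f k) + f k) * K       ≡⟨ ℚ.*-distribʳ-+ K (sumℚ (applyUpTo f k)) (f k) ⟩
    sumℚ (applyUpTo f k) * K + f k * K     ≡⟨ cong₂ _+_ (sumℚ-applyUpTo K f g eq k) (eq k) ⟩
    fromℤ (sumTo k g) + fromℤ (g k)        ≡⟨ sym (fromℤ-+ (sumTo k g) (g k)) ⟩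
    fromℤ (sumTo (suc k) g)                ∎
    where open ≡-Reasoning

  discrepancyL2-scaled : ∀ {n} (Z : List (Word n)) → 1 ℕ.≤ length Z →
    let K = fromℤ (+ length Z) * fromℤ (+ (2 ℕ.^ n)) in
    discrepancyL2 Z * (K * K) ≡ fromℤ (scaledDiscrepancy Z)
  discrepancyL2-scaled {n} Z N≥1 = trans (cong (λ xs → sumℚ xs * (K * K)) (map-upTo D (suc n)))
    (sumℚ-applyUpTo (K * K) D _
      (λ t → sumℚ-allWords (K * K) (λ x → d t x * d t x) (λ x → deviation Z t x ℤ.* deviation Z t x) (term t)) (suc n))
    where
    open ≡-Reasoning
    N = fromℤ (+ length Z)
    P = fromℤ (+ (2 ℕ.^ n))
    K = N * P
    d : ℕ → Word n → ℚ
    d t x = frac (countIn x t Z) (length Z) - frac (ballSize x t) (2 ℕ.^ n)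
    D : ℕ → ℚ
    D t = sumℚ (map (λ x → d t x * d t x) (allWords n))

    d*K : ∀ t x → d t x * K ≡ fromℤ (deviation Z t x)
    d*K t x = begin
      (p - q) * (N * P)
        ≡⟨ ℚ.*-distribʳ-+ (N * P) p (- q) ⟩
      p * (N * P) + - q * (N * P)
        ≡⟨ cong₂ _+_ (sym (ℚ.*-assoc p N P)) (trans (cong (- q *_) (ℚ.*-comm N P)) (sym (ℚ.*-assoc (- q) P N))) ⟩
      p * N * P + - q * P * N
        ≡⟨ cong₂ (λ y z → y * P + z * N) (frac*denominator (countIn x t Z) (length Z) N≥1)
             (trans (sym (ℚ.neg-distribˡ-* q P))
                    (cong -_ (frac*denominator (ballSize x t) (2 ℕ.^ n) (ℕ.m^n>0 2 n)))) ⟩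
      fromℤ (+ countIn x t Z) * P + - fromℤ (+ ballSize x t) * N
        ≡⟨ cong₂ _+_ (sym (fromℤ-* (+ countIn x t Z) (+ (2 ℕ.^ n))))
             (trans (cong (_* N) (sym (fromℤ-neg (+ ballSize x t)))) (sym (fromℤ-* (ℤ.- (+ ballSize x t)) (+ length Z)))) ⟩
      fromℤ (+ countIn x t Z ℤ.* + (2 ℕ.^ n)) + fromℤ (ℤ.- (+ ballSize x t) ℤ.* + length Z)
        ≡⟨ sym (fromℤ-+ (+ countIn x t Z ℤ.* + (2 ℕ.^ n)) (ℤ.- (+ ballSize x t) ℤ.* + length Z)) ⟩
      fromℤ (+ countIn x t Z ℤ.* + (2 ℕ.^ n) ℤ.+ ℤ.- (+ ballSize x t) ℤ.* + length Z)
        ≡⟨ cong (λ v → fromℤ (+ countIn x t Z ℤ.* + (2 ℕ.^ n) ℤ.+ ℤ.- v ℤ.* + length Z)) (ballSize-volume x t) ⟩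
      fromℤ (+ countIn x t Z ℤ.* + (2 ℕ.^ n) ℤ.+ ℤ.- volume n t ℤ.* + length Z)
        ≡⟨ cong fromℤ (ring (+ countIn x t Z) (+ (2 ℕ.^ n)) (volume n t) (+ length Z)) ⟩
      fromℤ (deviation Z t x) ∎
      where
      p = frac (countIn x t Z) (length Z)
      q = frac (ballSize x t) (2 ℕ.^ n)
      ring : ∀ c p v l → c ℤ.* p ℤ.+ ℤ.- v ℤ.* l ≡ p ℤ.* c ℤ.+ ℤ.- l ℤ.* v
      ring = ℤ-Solver.solve-∀

    term : ∀ t x → d t x * d t x * (K * K) ≡ fromℤ (deviation Z t x ℤ.* deviation Z t x)
    term t x = begin
      d t x * d t x * (K * K)                             ≡⟨ *-interchange (d t x) (d t x) K K ⟩
      d t x * K * (d t x * K)                             ≡⟨ cong₂ _*_ (d*K t x) (d*K t x) ⟩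
      fromℤ (deviation Z t x) * fromℤ (deviation Z t x)   ≡⟨ sym (fromℤ-* (deviation Z t x) (deviation Z t x)) ⟩
      fromℤ (deviation Z t x ℤ.* deviation Z t x)         ∎

  -- An empty code covers nothing. Positivity of N excludes the default value of `frac` and makes
  -- the scale cancellable.
  perfect-nonempty : ∀ {n} (Z : List (Word n)) → IsPerfect Z → 1 ℕ.≤ length Z
  perfect-nonempty (z ∷ Z) _ = s≤s z≤n
  perfect-nonempty []      (e , perfect) with () ← perfect 𝟎

  perfect⇒minimal : ∀ {n} (Z Z′ : List (Word n)) → IsPerfect Z → length Z′ ≡ length Z →
    discrepancyL2 Z ≤ discrepancyL2 Z′
  perfect⇒minimal {n} Z Z′ perfect same = ℚ.*-cancelʳ-≤-pos (K * K) {{K²>0}}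
    (subst₂ _≤_ (sym (discrepancyL2-scaled Z N≥1)) (sym scaled′) (fromℤ-mono (perfect-minimises Z Z′ perfect same)))
    where
    K = fromℤ (+ length Z) * fromℤ (+ (2 ℕ.^ n))
    N≥1 = perfect-nonempty Z perfect
    scaled′ : discrepancyL2 Z′ * (K * K) ≡ fromℤ (scaledDiscrepancy Z′)
    scaled′ = subst (λ l → let K′ = fromℤ (+ l) * fromℤ (+ (2 ℕ.^ n)) in
      discrepancyL2 Z′ * (K′ * K′) ≡ fromℤ (scaledDiscrepancy Z′)) same
      (discrepancyL2-scaled Z′ (subst (1 ℕ.≤_) (sym same) N≥1))
    fromℤ>0 : ∀ {m} → 1 ℕ.≤ m → Positive (fromℤ (+ m))
    fromℤ>0 (s≤s _) = _
    K>0 : Positive K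
    K>0 = ℚ.pos*pos⇒pos (fromℤ (+ length Z)) {{fromℤ>0 N≥1}} (fromℤ (+ (2 ℕ.^ n))) {{fromℤ>0 (ℕ.m^n>0 2 n)}}
    K²>0 : Positive (K * K)
    K²>0 = ℚ.pos*pos⇒pos K {{K>0}} K {{K>0}}

open import Data.Rational using (_≤_)

theorem5p3 : (n : ℕ) (Z : List (Vec Bool n)) → Unique Z → IsPerfect Z →
    (Z′ : List (Vec Bool n)) → Unique Z′ → length Z′ ≡ length Z →
    discrepancyL2 Z ≤ discrepancyL2 Z′
theorem5p3 n Z _ perfect Z′ _ same = RationalDiscrepancy.perfect⇒minimal Z Z′ perfect same
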